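{- $\mathsf{RCA}_0+\Sigma^1_1\text{ - }\mathsf{Rfn}$ is not $\Sigma^1_1$-conservative over $\mathsf{RCA}_0$, and $\mathsf{WKL}_0+\Sigma^1_1\text{ - }\mathsf{Rfn}$ is not $\Sigma^1_1$-conservative over $\mathsf{WKL}_0$. That is, in each case there is a $\Sigma^1_1$ sentence provable in the extended theory but not in the base theory.
   Context: $L_2$ is the two-sorted language of second-order arithmetic with $0,1,+,\cdot$ and a unary function symbol $\mathsf{exp}$ for base-two exponentiation. $\Sigma^1_n,\Pi^1_n$ formulas are prefixes of set quantifiers followed by a matrix without set quantifiers. $\mathsf{RCA}_0^*$ is Robinson's $\mathsf{Q}$ with the recursive defining axioms of $\mathsf{exp}$, $\Delta^0_0$-induction and $\Delta^0_1$-comprehension (with parameters); $\mathsf{RCA}_0$ is $\mathsf{RCA}_0^*$ plus $\Sigma^0_1$-induction with set parameters; $\mathsf{WKL}_0$ is $\mathsf{RCA}_0$ plus weak K\"onig's lemma. Fix a monotone primitive recursive pairing bijection $\langle\cdot,\cdot\rangle$ on the naturals; the $i$-th section of $Y$ is $(Y)_i=\{m:\langle i,m\rangle\in Y\}$. Write $X\dot\in Y$ for $\exists z\,((Y)_z=X)$. $\varphi^Y$ is $\varphi$ with all set quantifiers relativized to the sections of $Y$. For an $L_2$ formula $\varphi(\vec P,\vec x,\vec X)$ with all free variables displayed, $\mathsf{Rfn}_\varphi$ is the sentence $$\forall\vec P\,\exists Y\,\Bigl(\vec P\dot\in Y\wedge\forall\vec x\,\forall\vec X\dot\in Y\,\bigl(\varphi(\vec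 P,\vec x,\vec X)\leftrightarrow\varphi^Y(\vec P,\vec x,\vec X)\bigr)\Bigr),$$ where $\vec P\dot\in Y$ means that each $P_i$ is a section of $Y$ and $\forall\vec X\dot\in Y$ ranges over tuples of sections of $Y$. $\Sigma^1_1\text{ - }\mathsf{Rfn}$ is the scheme of all $\mathsf{Rfn}_\varphi$ for $\varphi$ a $\Sigma^1_1$ or $\Pi^1_1$ formula. -}

module Defs where

open import Data.Nat using (ℕ; zero; suc; _+_)
open import Data.Fin using (Fin; zero; suc; lift; _↑ˡ_; _↑ʳ_)
open import Data.List using (List; []; _∷_; map)
open import Data.List.Membership.Propositional using () renaming (_∈_ to _∈ˡ_)
open import Data.Sum using (_⊎_)
open import Data.Vec.Functional using (Vector; foldr) renaming (_∷_ to _▹_)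
open import Function using (_∘_; id)

-- A term has its n number variables, and a formula its n number variables and
-- m set variables, as de Bruijn indices; the two sorts are indexed separately.

infixl 9 _⊗_
infixl 8 _⊕_
infix  7 _≐_ _≼_ _≺_ _∈_ _∈̇_ _⊑_
infix  6 ∼_
infixr 5 _∧_
infixr 4 _∨_
infixr 3 _⇒_
infix  2 _⇔_
infix  1 _▸_⊢_ _⊢_

data Term (n : ℕ) : Set where
  var     : Fin n → Term n
  𝟎 𝟏     : Term n
  _⊕_ _⊗_ : Term n → Term n → Term n
  exp     : Term n → Term n

data Formula (n m : ℕ) : Set where
  _≐_         : Term n → Term n → Formula n m
  _∈_         : Term n → Fin m → Formula n m
  ⊥           : Formula n m
  _∧_ _∨_ _⇒_ : Formula n m → Formula n m → Formula n m
  ∀¹ ∃¹       : Formula (suc n) m → Formula n m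
  ∀² ∃²       : Formula n (suc m) → Formula n m

Sentence : Set
Sentence = Formula 0 0

Theory : Set₁
Theory = Sentence → Set

∼_ : ∀ {n m} → Formula n m → Formula n m
∼ φ = φ ⇒ ⊥

⊤ : ∀ {n m} → Formula n m
⊤ = ∼ ⊥

_⇔_ : ∀ {n m} → Formula n m → Formula n m → Formula n m
φ ⇔ ψ = (φ ⇒ ψ) ∧ (ψ ⇒ φ)

⋀ : ∀ {k n m} → Vector (Formula n m) k → Formula n m
⋀ = foldr _∧_ ⊤

subT : ∀ {n n′} → Vector (Term n′) n → Term n → Term n′
subT σ (var i) = σ i
subT σ 𝟎       = 𝟎
subT σ 𝟏       = 𝟏
subT σ (s ⊕ t) = subT σ s ⊕ subT σ t
subT σ (s ⊗ t) = subT σ s ⊗ subT σ t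
subT σ (exp t) = exp (subT σ t)

wkT : ∀ {n} → Term n → Term (suc n)
wkT = subT (var ∘ suc)

-- Simultaneous substitution of terms for number variables and of set variables
-- for set variables (the only terms of the set sort are variables).
sub : ∀ {n n′ m m′} → Vector (Term n′) n → (Fin m → Fin m′) →
      Formula n m → Formula n′ m′
sub σ ρ (s ≐ t) = subT σ s ≐ subT σ t
sub σ ρ (t ∈ X) = subT σ t ∈ ρ X
sub σ ρ ⊥       = ⊥
sub σ ρ (φ ∧ ψ) = sub σ ρ φ ∧ sub σ ρ ψ
sub σ ρ (φ ∨ ψ) = sub σ ρ φ ∨ sub σ ρ ψ
sub σ ρ (φ ⇒ ψ) = sub σ ρ φ ⇒ sub σ ρ ψ
sub σ ρ (∀¹ φ)  = ∀¹ (sub (var zero ▹ (wkT ∘ σ)) ρ φ)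
sub σ ρ (∃¹ φ)  = ∃¹ (sub (var zero ▹ (wkT ∘ σ)) ρ φ)
sub σ ρ (∀² φ)  = ∀² (sub σ (lift 1 ρ) φ)
sub σ ρ (∃² φ)  = ∃² (sub σ (lift 1 ρ) φ)

wk¹ : ∀ {n m} → Formula n m → Formula (suc n) m
wk¹ = sub (var ∘ suc) id

wk² : ∀ {n m} → Formula n m → Formula n (suc m)
wk² = sub var suc

infix 10 _[_]¹ _[_]²

_[_]¹ : ∀ {n m} → Formula (suc n) m → Term n → Formula n m
φ [ t ]¹ = sub (t ▹ var) id φ

_[_]² : ∀ {n m} → Formula n (suc m) → Fin m → Formula n m
φ [ X ]² = sub var (X ▹ id) φ

embed : ∀ {n m} → Sentence → Formula n m
embed = sub (λ ()) (λ ())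

close¹ : ∀ {n m} → Formula n m → Formula 0 m
close¹ {zero}  φ = φ
close¹ {suc n} φ = close¹ (∀¹ φ)

close² : ∀ {n m} → Formula n m → Formula n 0
close² {m = zero}  φ = φ
close² {m = suc m} φ = close² (∀² φ)

closure : ∀ {n m} → Formula n m → Sentence
closure φ = close² (close¹ φ)

∀²* : ∀ k {n m} → Formula n (k + m) → Formula n m
∀²* zero    φ = φ
∀²* (suc k) φ = ∀²* k (∀² φ)

-- Classical two-sorted natural deduction with equality on numbers.
data _▸_⊢_ (T : Theory) {n m : ℕ} (Γ : List (Formula n m)) : Formula n m → Set where
  axiom : ∀ {σ} → T σ → T ▸ Γ ⊢ embed σ
  hyp   : ∀ {φ} → φ ∈ˡ Γ → T ▸ Γ ⊢ φ
  raa   : ∀ {φ} → T ▸ ∼ φ ∷ Γ ⊢ ⊥ → T ▸ Γ ⊢ φ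
  ⇒I    : ∀ {φ ψ} → T ▸ φ ∷ Γ ⊢ ψ → T ▸ Γ ⊢ φ ⇒ ψ
  ⇒E    : ∀ {φ ψ} → T ▸ Γ ⊢ φ ⇒ ψ → T ▸ Γ ⊢ φ → T ▸ Γ ⊢ ψ
  ∧I    : ∀ {φ ψ} → T ▸ Γ ⊢ φ → T ▸ Γ ⊢ ψ → T ▸ Γ ⊢ φ ∧ ψ
  ∧E₁   : ∀ {φ ψ} → T ▸ Γ ⊢ φ ∧ ψ → T ▸ Γ ⊢ φ
  ∧E₂   : ∀ {φ ψ} → T ▸ Γ ⊢ φ ∧ ψ → T ▸ Γ ⊢ ψ
  ∨I₁   : ∀ {φ ψ} → T ▸ Γ ⊢ φ → T ▸ Γ ⊢ φ ∨ ψ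
  ∨I₂   : ∀ {φ ψ} → T ▸ Γ ⊢ ψ → T ▸ Γ ⊢ φ ∨ ψ
  ∨E    : ∀ {φ ψ χ} → T ▸ Γ ⊢ φ ∨ ψ → T ▸ φ ∷ Γ ⊢ χ → T ▸ ψ ∷ Γ ⊢ χ → T ▸ Γ ⊢ χ
  ∀¹I   : ∀ {φ} → T ▸ map wk¹ Γ ⊢ φ → T ▸ Γ ⊢ ∀¹ φ
  ∀¹E   : ∀ {φ} → T ▸ Γ ⊢ ∀¹ φ → ∀ t → T ▸ Γ ⊢ φ [ t ]¹
  ∃¹I   : ∀ {φ} t → T ▸ Γ ⊢ φ [ t ]¹ → T ▸ Γ ⊢ ∃¹ φ
  ∃¹E   : ∀ {φ χ} → T ▸ Γ ⊢ ∃¹ φ → T ▸ φ ∷ map wk¹ Γ ⊢ wk¹ χ → T ▸ Γ ⊢ χ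
  ∀²I   : ∀ {φ} → T ▸ map wk² Γ ⊢ φ → T ▸ Γ ⊢ ∀² φ
  ∀²E   : ∀ {φ} → T ▸ Γ ⊢ ∀² φ → ∀ X → T ▸ Γ ⊢ φ [ X ]²
  ∃²I   : ∀ {φ} X → T ▸ Γ ⊢ φ [ X ]² → T ▸ Γ ⊢ ∃² φ
  ∃²E   : ∀ {φ χ} → T ▸ Γ ⊢ ∃² φ → T ▸ φ ∷ map wk² Γ ⊢ wk² χ → T ▸ Γ ⊢ χ
  -- There are no closed terms of the set sort, so that its domain is nonempty
  -- has to be said separately.
  set   : T ▸ Γ ⊢ ∃² ⊤
  ≐I    : ∀ {t} → T ▸ Γ ⊢ t ≐ t
  ≐E    : ∀ {s t} φ → T ▸ Γ ⊢ s ≐ t → T ▸ Γ ⊢ φ [ s ]¹ → T ▸ Γ ⊢ φ [ t ]¹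

_⊢_ : Theory → Sentence → Set
T ⊢ σ = T ▸ [] ⊢ σ

v₀ : ∀ {n} → Term (suc n)
v₀ = var zero

v₁ : ∀ {n} → Term (suc (suc n))
v₁ = var (suc zero)

_≼_ _≺_ : ∀ {n m} → Term n → Term n → Formula n m
s ≼ t = ∃¹ (v₀ ⊕ wkT s ≐ wkT t)
s ≺ t = s ⊕ 𝟏 ≼ t

data Δ⁰₀ {n m : ℕ} : Formula n m → Set where
  _≐_ : ∀ s t → Δ⁰₀ (s ≐ t)
  _∈_ : ∀ t X → Δ⁰₀ (t ∈ X)
  ⊥   : Δ⁰₀ ⊥
  _∧_ : ∀ {φ ψ} → Δ⁰₀ φ → Δ⁰₀ ψ → Δ⁰₀ (φ ∧ ψ)
  _∨_ : ∀ {φ ψ} → Δ⁰₀ φ → Δ⁰₀ ψ → Δ⁰₀ (φ ∨ ψ)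
  _⇒_ : ∀ {φ ψ} → Δ⁰₀ φ → Δ⁰₀ ψ → Δ⁰₀ (φ ⇒ ψ)
  ∀≺  : ∀ t {φ} → Δ⁰₀ φ → Δ⁰₀ (∀¹ (v₀ ≺ wkT t ⇒ φ))
  ∃≺  : ∀ t {φ} → Δ⁰₀ φ → Δ⁰₀ (∃¹ (v₀ ≺ wkT t ∧ φ))

data Σ⁰₁ {n m : ℕ} : Formula n m → Set where
  matrix : ∀ {φ} → Δ⁰₀ φ → Σ⁰₁ φ
  ∃¹     : ∀ {φ} → Σ⁰₁ φ → Σ⁰₁ (∃¹ φ)

data Π⁰₁ {n m : ℕ} : Formula n m → Set where
  matrix : ∀ {φ} → Δ⁰₀ φ → Π⁰₁ φ
  ∀¹     : ∀ {φ} → Π⁰₁ φ → Π⁰₁ (∀¹ φ)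

data Arithmetical {n m : ℕ} : Formula n m → Set where
  _≐_ : ∀ s t → Arithmetical (s ≐ t)
  _∈_ : ∀ t X → Arithmetical (t ∈ X)
  ⊥   : Arithmetical ⊥
  _∧_ : ∀ {φ ψ} → Arithmetical φ → Arithmetical ψ → Arithmetical (φ ∧ ψ)
  _∨_ : ∀ {φ ψ} → Arithmetical φ → Arithmetical ψ → Arithmetical (φ ∨ ψ)
  _⇒_ : ∀ {φ ψ} → Arithmetical φ → Arithmetical ψ → Arithmetical (φ ⇒ ψ)
  ∀¹  : ∀ {φ} → Arithmetical φ → Arithmetical (∀¹ φ)
  ∃¹  : ∀ {φ} → Arithmetical φ → Arithmetical (∃¹ φ)

data Σ¹₁ {n m : ℕ} : Formula n m → Set where
  matrix : ∀ {φ} → Arithmetical φ → Σ¹₁ φ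
  ∃²     : ∀ {φ} → Σ¹₁ φ → Σ¹₁ (∃² φ)

data Π¹₁ {n m : ℕ} : Formula n m → Set where
  matrix : ∀ {φ} → Arithmetical φ → Π¹₁ φ
  ∀²     : ∀ {φ} → Π¹₁ φ → Π¹₁ (∀² φ)

-- Variable 0 of φ is the induction variable; the others are parameters.
Induction : ∀ {n m} → Formula (suc n) m → Sentence
Induction φ =
  closure (φ [ 𝟎 ]¹ ∧ ∀¹ (φ ⇒ sub (v₀ ⊕ 𝟏 ▹ (var ∘ suc)) id φ) ⇒ ∀¹ φ)

Comprehension : ∀ {n m} → Formula (suc n) m → Formula (suc n) m → Sentence
Comprehension φ ψ =
  closure (∀¹ (φ ⇔ ψ) ⇒ ∃² (∀¹ (v₀ ∈ zero ⇔ wk² φ)))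

data RCA₀* : Theory where
  suc≢0  : RCA₀* (∀¹ (∼ v₀ ⊕ 𝟏 ≐ 𝟎))
  sucInj : RCA₀* (∀¹ (∀¹ (v₁ ⊕ 𝟏 ≐ v₀ ⊕ 𝟏 ⇒ v₁ ≐ v₀)))
  pred   : RCA₀* (∀¹ (∼ v₀ ≐ 𝟎 ⇒ ∃¹ (v₁ ≐ v₀ ⊕ 𝟏)))
  +0     : RCA₀* (∀¹ (v₀ ⊕ 𝟎 ≐ v₀))
  +suc   : RCA₀* (∀¹ (∀¹ (v₁ ⊕ (v₀ ⊕ 𝟏) ≐ v₁ ⊕ v₀ ⊕ 𝟏)))
  ·0     : RCA₀* (∀¹ (v₀ ⊗ 𝟎 ≐ 𝟎))
  ·suc   : RCA₀* (∀¹ (∀¹ (v₁ ⊗ (v₀ ⊕ 𝟏) ≐ v₁ ⊗ v₀ ⊕ v₁)))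
  exp0   : RCA₀* (exp 𝟎 ≐ 𝟏)
  expSuc : RCA₀* (∀¹ (exp (v₀ ⊕ 𝟏) ≐ (𝟏 ⊕ 𝟏) ⊗ exp v₀))
  Δ⁰₀-IND : ∀ {n m} {φ : Formula (suc n) m} → Δ⁰₀ φ → RCA₀* (Induction φ)
  Δ⁰₁-CA  : ∀ {n m} {φ ψ : Formula (suc n) m} → Σ⁰₁ φ → Π⁰₁ ψ →
            RCA₀* (Comprehension φ ψ)

data RCA₀ : Theory where
  base    : ∀ {σ} → RCA₀* σ → RCA₀ σ
  Σ⁰₁-IND : ∀ {n m} {φ : Formula (suc n) m} → Σ⁰₁ φ → RCA₀ (Induction φ)

-- A finite binary sequence of length ℓ with entries b₀,…,b_{ℓ-1} is coded by
-- the positive number 2^ℓ + Σ_{i<ℓ} bᵢ·2^i.  This is a bijection.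

Bit : ∀ {n m} → Term n → Term n → Formula n m
Bit i c =
  ∃¹ (∃¹ (v₀ ≺ exp (wkT (wkT i)) ∧
          wkT (wkT c) ≐ (v₁ ⊕ v₁ ⊕ 𝟏) ⊗ exp (wkT (wkT i)) ⊕ v₀))

Length : ∀ {n m} → Term n → Term n → Formula n m
Length ℓ c = exp ℓ ≼ c ∧ c ≺ exp (ℓ ⊕ 𝟏)

-- d codes an initial segment of the sequence coded by c; inside, v₁ and v₀ are
-- the lengths of d and c.
_⊑_ : ∀ {n m} → Term n → Term n → Formula n m
d ⊑ c =
  ∃¹ (∃¹ (Length v₁ (wkT (wkT d)) ∧ Length v₀ (wkT (wkT c)) ∧ v₁ ≼ v₀ ∧
          ∀¹ (v₀ ≺ wkT v₁ ⇒
              (Bit v₀ (wkT (wkT (wkT d))) ⇔ Bit v₀ (wkT (wkT (wkT c)))))))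

BinaryTree : ∀ {n m} → Fin m → Formula n m
BinaryTree T =
  ∀¹ (v₀ ∈ T ⇒ ∃¹ (Length v₀ v₁) ∧ ∀¹ (v₀ ⊑ v₁ ⇒ v₀ ∈ T))

Infinite : ∀ {n m} → Fin m → Formula n m
Infinite T = ∀¹ (∃¹ (v₁ ≺ v₀ ∧ v₀ ∈ T))

-- X is the set of positions at which the path takes the value 1; inside, v₁ is
-- a length and v₀ the code of the initial segment of that length.
Path : ∀ {n m} → Fin m → Fin m → Formula n m
Path X T =
  ∀¹ (∃¹ (v₀ ∈ T ∧ Length v₁ v₀ ∧ ∀¹ (v₀ ≺ wkT v₁ ⇒ (Bit v₀ v₁ ⇔ v₀ ∈ X))))

WKL : Sentence
WKL = ∀² (BinaryTree zero ∧ Infinite zero ⇒ ∃² (Path zero (suc zero)))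

data WKL₀ : Theory where
  base : ∀ {σ} → RCA₀ σ → WKL₀ σ
  wkl  : WKL₀ WKL

-- p = ⟨i,x⟩ for Cantor's pairing ⟨i,x⟩ = (i + x)(i + x + 1)/2 + x.
Pair : ∀ {n m} → Term n → Term n → Term n → Formula n m
Pair i x p = p ⊕ p ≐ (i ⊕ x) ⊗ (i ⊕ x ⊕ 𝟏) ⊕ (x ⊕ x)

-- x ∈ (Y)ᵢ
InSection : ∀ {n m} → Term n → Fin m → Term n → Formula n m
InSection x Y i = ∃¹ (Pair (wkT i) (wkT x) v₀ ∧ v₀ ∈ Y)

-- (Y)_z = X is extensional equality, as sets have no primitive equality.
_∈̇_ : ∀ {n m} → Fin m → Fin m → Formula n m
X ∈̇ Y = ∃¹ (∀¹ (InSection v₀ Y v₁ ⇔ v₀ ∈ X))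

_^_ : ∀ {n m} → Formula n m → Fin m → Formula n m
(s ≐ t) ^ Y = s ≐ t
(t ∈ X) ^ Y = t ∈ X
⊥       ^ Y = ⊥
(φ ∧ ψ) ^ Y = φ ^ Y ∧ ψ ^ Y
(φ ∨ ψ) ^ Y = φ ^ Y ∨ ψ ^ Y
(φ ⇒ ψ) ^ Y = φ ^ Y ⇒ ψ ^ Y
(∀¹ φ)  ^ Y = ∀¹ (φ ^ Y)
(∃¹ φ)  ^ Y = ∃¹ (φ ^ Y)
(∀² φ)  ^ Y = ∀² (zero ∈̇ suc Y ⇒ φ ^ suc Y)
(∃² φ)  ^ Y = ∃² (zero ∈̇ suc Y ∧ φ ^ suc Y)

-- Among the set variables of φ, the first k are X⃗ and the last p are P⃗.  In φ′
-- the variable Y has been inserted between the two blocks.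
Rfn : ∀ {n} k p → Formula n (k + p) → Sentence
Rfn k p φ =
  close² (∃² (⋀ {p} (λ i → suc i ∈̇ zero) ∧
              close¹ (∀²* k (⋀ {k} (λ j → (j ↑ˡ suc p) ∈̇ Y) ⇒ (φ′ ⇔ φ′ ^ Y)))))
  where
  Y : Fin (k + suc p)
  Y = k ↑ʳ zero

  φ′ : Formula _ (k + suc p)
  φ′ = sub var (lift k suc) φ

data Σ¹₁-Rfn : Theory where
  rfn : ∀ {n} k p {φ : Formula n (k + p)} → Σ¹₁ φ ⊎ Π¹₁ φ → Σ¹₁-Rfn (Rfn k p φ)

{-# OPTIONS --safe #-}
module Submission where

open import Defs
open import Data.Empty using () renaming (⊥ to Empty)
open import Data.Fin using (Fin; zero; suc; #_; lift)
open import Data.List using (List; []; _∷_; map; lookup)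
open import Data.List.Membership.Propositional using () renaming (_∈_ to _∈ˡ_)
open import Data.List.Membership.Propositional.Properties using (∈-map⁻; ∈-lookup)
open import Data.List.Relation.Unary.Any using (here; there)
open import Data.Maybe using (Maybe; just; nothing; maybe′)
open import Data.Nat using (ℕ; zero; suc; _+_; _*_; _∸_; _⊔_; _<_; _≤_; z≤n; s≤s)
  renaming (_^_ to _**_; _≟_ to _≟ᴺ_)
open import Data.Nat.DivMod
open import Data.Nat.Divisibility using (n∣m*n)
open import Data.Nat.Induction using (<-rec)
open import Data.Nat.Properties
open import Data.Nat.Tactic.RingSolver using (solve-∀)
open import Data.Product using (Σ; ∃; ∃-syntax; _×_; _,_; proj₁; proj₂)
open import Data.Sum using (_⊎_; inj₁; inj₂)
import Data.Sum as Sum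
open import Data.Unit using (tt) renaming (⊤ to Unit)
open import Data.Vec.Functional using (Vector) renaming (_∷_ to _▹_)
open import Function using (_∘_; id; case_of_)
open import Relation.Binary.Definitions using (tri<; tri≈; tri>)
open import Relation.Binary.PropositionalEquality using (_≡_; refl; sym; trans; cong; cong₂; subst; subst₂)
open import Relation.Nullary using (¬_; Dec; yes; no)
open import Relation.Nullary.Decidable using (decidable-stable; ¬¬-excluded-middle)
open import Relation.Nullary.Negation using (¬¬-map; contradiction)
open import Relation.Unary using (_∪_)

-- Given an arithmetical formula θ, reflect φ(e) = ∃Z Z = { x : θ(x, e) }. The
-- set Y obtained contains every set of the form { x : θ(x, e) } among its
-- sections, while { x : x ∉ (Y)ₓ } is not a section of Y. Hence reflection proves
-- the Σ¹₁ sentence "there is a set that is not of the form { x : θ(x, e) }".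
-- For a suitable θ this sentence fails in an ω-model of WKL₀ all of whose sets
-- are of that form. The model consists of the sections of a single set W that
-- solves infinitely many conditions, which make the sections closed under the
-- instructions of a stack machine (hence under Δ⁰₁ comprehension) and under
-- passing from a tree to a path. Each condition depends on finitely many values
-- of W, so by compactness there is a solution, and the leftmost one is
-- arithmetically definable.

-- The recursive sets do not satisfy weak König's lemma, and no arithmetical θ enumerates all
-- arithmetical sets; hence a coded ω-model with an arithmetical code. To get the code as the
-- leftmost solution of conditions with finite use, every closure requirement must be checkable on a
-- finite part of W. Two are not so by nature: a search may fail, and a tree may turn out to be
-- finite. Both are weakened. A search is constrained only once some number that passes the test is
-- at hand, and a path only at those lengths that the tree still reaches. In the remaining cases W
-- may answer as it likes, so the conditions do not determine W, and a choice such as the leftmost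
-- one is needed. The metatheory is constructive. Sets are therefore stable predicates and not
-- decidable ones, and witnesses are found under a double negation; the final goal is a negation, so
-- this is enough. A model of WKL₀ is also one of RCA₀, so that one sentence and one model settle
-- both claims.

infix 1 _↔_

_↔_ : Set → Set → Set
A ↔ B = (A → B) × (B → A)

↔-refl : ∀ {A} → A ↔ A
↔-refl = id , id

↔-sym : ∀ {A B} → A ↔ B → B ↔ A
↔-sym (f , g) = g , f

↔-trans : ∀ {A B C} → A ↔ B → B ↔ C → A ↔ C
↔-trans (f , g) (h , k) = h ∘ f , g ∘ k

≡⇒↔ : ∀ {A B : Set} → A ≡ B → A ↔ B
≡⇒↔ refl = ↔-refl

¬-cong : ∀ {A B} → A ↔ B → ¬ A ↔ ¬ B
¬-cong (f , g) = (_∘ g) , (_∘ f)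

×-cong : ∀ {A B C D} → A ↔ B → C ↔ D → A × C ↔ B × D
×-cong (f , g) (h , k) = (λ { (a , c) → f a , h c }) , λ { (b , d) → g b , k d }

→-cong : ∀ {A B C D} → A ↔ B → C ↔ D → (A → C) ↔ (B → D)
→-cong (f , g) (h , k) = (λ u → h ∘ u ∘ g) , λ u → k ∘ u ∘ f

⇔-cong : ∀ {A B C D} → A ↔ B → C ↔ D → (A ↔ C) ↔ (B ↔ D)
⇔-cong e f = ×-cong (→-cong e f) (→-cong f e)

Π-cong : ∀ {I : Set} {A B : I → Set} → (∀ i → A i ↔ B i) → (∀ i → A i) ↔ (∀ i → B i)
Π-cong e = (λ u i → proj₁ (e i) (u i)) , λ u i → proj₂ (e i) (u i)

¬¬⊎-cong : ∀ {A B C D} → A ↔ B → C ↔ D → ¬ ¬ (A ⊎ C) ↔ ¬ ¬ (B ⊎ D)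
¬¬⊎-cong (f , g) (h , k) = ¬¬-map (Sum.map f h) , ¬¬-map (Sum.map g k)

¬¬∃-cong : ∀ {I : Set} {A B : I → Set} → (∀ i → A i ↔ B i) → ¬ ¬ ∃ A ↔ ¬ ¬ ∃ B
¬¬∃-cong e = ¬¬-map (λ { (i , a) → i , proj₁ (e i) a }) , ¬¬-map λ { (i , b) → i , proj₂ (e i) b }

-- Binary digits

bit : ℕ → ℕ → Set
bit zero    c = c % 2 ≡ 1
bit (suc i) c = bit i (c / 2)

bit-stable : ∀ i {c} → ¬ ¬ bit i c → bit i c
bit-stable zero    = decidable-stable (_ ≟ᴺ _)
bit-stable (suc i) = bit-stable i

[r+2q]%2 : ∀ q {r} → r < 2 → (q * 2 + r) % 2 ≡ r
[r+2q]%2 q {r} r<2 = trans (cong (_% 2) (+-comm (q * 2) r)) (trans ([m+kn]%n≡m%n r q 2) (m<n⇒m%n≡m r<2))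

[r+2q]/2 : ∀ q r → (q * 2 + r) / 2 ≡ q + r / 2
[r+2q]/2 q r = trans (+-distrib-/-∣ˡ r (n∣m*n q)) (cong (_+ r / 2) (m*n/n≡m q 2))

double : ∀ a b c → a * (2 * b) + c ≡ (a * b) * 2 + c
double = solve-∀

m/2<2^n : ∀ {m n} → m < 2 ** suc n → m / 2 < 2 ** n
m/2<2^n {m} {n} h = m<n*o⇒m/o<n (subst (m <_) (*-comm 2 (2 ** n)) h)

bit-mod : ∀ {i ℓ} → i < ℓ → ∀ a r → bit i (a * 2 ** ℓ + r) ↔ bit i r
bit-mod {zero}  {suc ℓ} _ a r = ≡⇒↔ (cong (_≡ 1) (trans
  (cong (_% 2) (trans (double a (2 ** ℓ) r) (+-comm _ r))) ([m+kn]%n≡m%n r (a * 2 ** ℓ) 2)))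
bit-mod {suc i} {suc ℓ} (s≤s h) a r = subst (λ x → bit i x ↔ bit i (r / 2))
  (sym (trans (cong (_/ 2) (double a (2 ** ℓ) r)) ([r+2q]/2 (a * 2 ** ℓ) r))) (bit-mod h a (r / 2))

digit⇒bit : ∀ i a {b c} → b < 2 ** i → c ≡ (a + a + 1) * 2 ** i + b → bit i c
digit⇒bit zero a {zero} _ refl = trans (cong (_% 2) (eq a)) ([r+2q]%2 a (s≤s (s≤s z≤n)))
  where
  eq : ∀ a → (a + a + 1) * 1 + 0 ≡ a * 2 + 1
  eq = solve-∀
digit⇒bit zero a {suc b} (s≤s ()) _
digit⇒bit (suc i) a {b} h refl = digit⇒bit i a (m/2<2^n {n = i} h)
  (trans (cong (_/ 2) (double (a + a + 1) (2 ** i) b)) ([r+2q]/2 ((a + a + 1) * 2 ** i) b))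

bit⇒digit : ∀ i {c} → bit i c → ∃[ a ] ∃[ b ] b < 2 ** i × c ≡ (a + a + 1) * 2 ** i + b
bit⇒digit zero {c} h = c / 2 , 0 , s≤s z≤n , 
  trans (m≡m%n+[m/n]*n c 2) (trans (cong (_+ c / 2 * 2) h) (eq (c / 2)))
  where
  eq : ∀ a → 1 + a * 2 ≡ (a + a + 1) * 1 + 0
  eq = solve-∀
bit⇒digit (suc i) {c} h with bit⇒digit i {c / 2} h
... | a , b , b< , e = a , b * 2 + c % 2 , d< ,
  trans (m≡m%n+[m/n]*n c 2) (trans (cong (λ x → c % 2 + x * 2) e) (eq (c % 2) (a + a + 1) (2 ** i) b))
  where
  d< : b * 2 + c % 2 < 2 ** suc i
  d< = begin-strict
    b * 2 + c % 2  <⟨ +-monoʳ-< (b * 2) (m%n<n c 2) ⟩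
    b * 2 + 2      ≡⟨ +-comm (b * 2) 2 ⟩
    suc b * 2      ≤⟨ *-monoˡ-≤ 2 b< ⟩
    2 ** i * 2     ≡⟨ *-comm (2 ** i) 2 ⟩
    2 ** suc i     ∎
    where open ≤-Reasoning
  eq : ∀ x y z w → x + (y * z + w) * 2 ≡ y * (2 * z) + (w * 2 + x)
  eq = solve-∀

bit-injective : ∀ ℓ {q r} → q < 2 ** ℓ → r < 2 ** ℓ → (∀ i → i < ℓ → bit i q ↔ bit i r) → q ≡ r
bit-injective zero {zero} {zero} _ _ _ = refl
bit-injective zero {suc q} (s≤s ()) _ _
bit-injective zero {zero} {suc r} _ (s≤s ()) _
bit-injective (suc ℓ) {q} {r} hq hr e =
  trans (m≡m%n+[m/n]*n q 2) (trans (cong₂ (λ x y → x + y * 2) parity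
    (bit-injective ℓ (m/2<2^n {n = ℓ} hq) (m/2<2^n {n = ℓ} hr)
      λ i i<ℓ → e (suc i) (s≤s i<ℓ)))
    (sym (m≡m%n+[m/n]*n r 2)))
  where
  parity : q % 2 ≡ r % 2
  parity with q % 2 | r % 2 | m%n<n q 2 | m%n<n r 2 | e 0 (s≤s z≤n)
  ... | 0 | 0 | _ | _ | _ = refl
  ... | 0 | 1 | _ | _ | _ , g = g refl
  ... | 1 | 0 | _ | _ | f , _ = sym (f refl)
  ... | 1 | 1 | _ | _ | _ = refl
  ... | suc (suc _) | _ | s≤s (s≤s ()) | _ | _
  ... | 0 | suc (suc _) | _ | s≤s (s≤s ()) | _
  ... | 1 | suc (suc _) | _ | s≤s (s≤s ()) | _

-- Excluded middle is applied ℓ times under the double negation. This is how an undecidable set is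
-- turned into a number wherever a code of an initial segment is called for.
¬¬-prefix : ∀ (V : ℕ → Set) ℓ → ¬ ¬ (∃[ r ] r < 2 ** ℓ × (∀ i → i < ℓ → bit i r ↔ V i))
¬¬-prefix V zero    k = k (0 , s≤s z≤n , λ _ ())
¬¬-prefix V (suc ℓ) k =
  ¬¬-excluded-middle λ V0? → ¬¬-prefix (V ∘ suc) ℓ λ { (r , r< , e) → k (extend V0? r r< e) }
  where
  extend : Dec (V 0) → ∀ r → r < 2 ** ℓ → (∀ i → i < ℓ → bit i r ↔ V (suc i)) →
           ∃[ r ] r < 2 ** suc ℓ × (∀ i → i < suc ℓ → bit i r ↔ V i)
  extend V0? r r< e = r * 2 + d , bound , λ
    { zero    _       → subst (λ x → x ≡ 1 ↔ V 0) (sym ([r+2q]%2 r d<2)) digit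
    ; (suc i) (s≤s h) → subst (λ x → bit i x ↔ V (suc i))
        (sym (trans ([r+2q]/2 r d) (trans (cong (r +_) (m<n⇒m/n≡0 d<2)) (+-identityʳ r)))) (e i h) }
    where
    choice : Σ ℕ λ d → d < 2 × (d ≡ 1 ↔ V 0)
    choice = case V0? of λ
      { (yes v) → 1 , s≤s (s≤s z≤n) , (λ _ → v) , λ _ → refl
      ; (no ¬v) → 0 , s≤s z≤n , (λ ()) , λ v → contradiction v ¬v }
    d = proj₁ choice
    d<2 = proj₁ (proj₂ choice)
    digit = proj₂ (proj₂ choice)
    bound : r * 2 + d < 2 ** suc ℓ
    bound = begin-strict
      r * 2 + d   <⟨ +-monoʳ-< (r * 2) d<2 ⟩
      r * 2 + 2   ≡⟨ +-comm (r * 2) 2 ⟩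
      suc r * 2   ≤⟨ *-monoˡ-≤ 2 r< ⟩
      2 ** ℓ * 2  ≡⟨ *-comm (2 ** ℓ) 2 ⟩
      2 ** suc ℓ  ∎
      where open ≤-Reasoning

-- Satisfaction in ω-structures and soundness

val : ∀ {n} → Term n → Vector ℕ n → ℕ
val (var i) ρ = ρ i
val 𝟎       ρ = 0
val 𝟏       ρ = 1
val (s ⊕ t) ρ = val s ρ + val t ρ
val (s ⊗ t) ρ = val s ρ * val t ρ
val (exp t) ρ = 2 ** val t ρ

val-sub : ∀ {n n′} {σ : Vector (Term n′) n} {ρ ρ′} → (∀ i → val (σ i) ρ ≡ ρ′ i) →
          ∀ t → val (subT σ t) ρ ≡ val t ρ′
val-sub h (var i) = h i
val-sub h 𝟎       = refl
val-sub h 𝟏       = refl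
val-sub h (s ⊕ t) = cong₂ _+_ (val-sub h s) (val-sub h t)
val-sub h (s ⊗ t) = cong₂ _*_ (val-sub h s) (val-sub h t)
val-sub h (exp t) = cong (2 **_) (val-sub h t)

val-wk : ∀ {n} (t : Term n) {x ρ} → val (wkT t) (x ▹ ρ) ≡ val t ρ
val-wk t = val-sub (λ _ → refl) t

val-wk₂ : ∀ {n} (t : Term n) {x y ρ} → val (wkT (wkT t)) (x ▹ (y ▹ ρ)) ≡ val t ρ
val-wk₂ t = trans (val-wk (wkT t)) (val-wk t)

-- Sets are given by indices, so that quantifying over them stays within `Set`, and so that a model
-- may use numbers as indices. Stability is what makes `raa` sound.
record ωStructure : Set₁ where
  field
    Index  : Set
    _∋_    : Index → ℕ → Set
    stable : ∀ {X x} → ¬ ¬ (X ∋ x) → X ∋ x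
    index  : Index

-- Satisfaction is read through the negative translation, so that it is stable
-- and classical logic is sound for it.
module Satisfaction (𝔐 : ωStructure) where
  open ωStructure 𝔐

  ⟦_⟧ : ∀ {n m} → Formula n m → Vector ℕ n → Vector Index m → Set
  ⟦ s ≐ t ⟧ ρ η = val s ρ ≡ val t ρ
  ⟦ t ∈ X ⟧ ρ η = η X ∋ val t ρ
  ⟦ ⊥ ⟧     ρ η = Empty
  ⟦ φ ∧ ψ ⟧ ρ η = ⟦ φ ⟧ ρ η × ⟦ ψ ⟧ ρ η
  ⟦ φ ∨ ψ ⟧ ρ η = ¬ ¬ (⟦ φ ⟧ ρ η ⊎ ⟦ ψ ⟧ ρ η)
  ⟦ φ ⇒ ψ ⟧ ρ η = ⟦ φ ⟧ ρ η → ⟦ ψ ⟧ ρ η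
  ⟦ ∀¹ φ ⟧  ρ η = ∀ x → ⟦ φ ⟧ (x ▹ ρ) η
  ⟦ ∃¹ φ ⟧  ρ η = ¬ ¬ (∃[ x ] ⟦ φ ⟧ (x ▹ ρ) η)
  ⟦ ∀² φ ⟧  ρ η = ∀ X → ⟦ φ ⟧ ρ (X ▹ η)
  ⟦ ∃² φ ⟧  ρ η = ¬ ¬ (∃[ X ] ⟦ φ ⟧ ρ (X ▹ η))

  ⟦⟧-stable : ∀ {n m} (φ : Formula n m) {ρ η} → ¬ ¬ ⟦ φ ⟧ ρ η → ⟦ φ ⟧ ρ η
  ⟦⟧-stable (s ≐ t) = decidable-stable (_ ≟ᴺ _)
  ⟦⟧-stable (t ∈ X) = stable
  ⟦⟧-stable ⊥       k = k id
  ⟦⟧-stable (φ ∧ ψ) k = ⟦⟧-stable φ (¬¬-map proj₁ k) , ⟦⟧-stable ψ (¬¬-map proj₂ k)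
  ⟦⟧-stable (φ ∨ ψ) k = λ h → k λ u → u h
  ⟦⟧-stable (φ ⇒ ψ) k = λ a → ⟦⟧-stable ψ (¬¬-map (λ f → f a) k)
  ⟦⟧-stable (∀¹ φ)  k = λ x → ⟦⟧-stable φ (¬¬-map (λ f → f x) k)
  ⟦⟧-stable (∃¹ φ)  k = λ h → k λ u → u h
  ⟦⟧-stable (∀² φ)  k = λ X → ⟦⟧-stable φ (¬¬-map (λ f → f X) k)
  ⟦⟧-stable (∃² φ)  k = λ h → k λ u → u h

  ⟦sub⟧ : ∀ {n n′ m m′} (φ : Formula n m) {σ : Vector (Term n′) n} {τ : Fin m → Fin m′} {ρ ρ′ η η′} →
          (∀ i → val (σ i) ρ ≡ ρ′ i) → (∀ X → η (τ X) ≡ η′ X) →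
          ⟦ sub σ τ φ ⟧ ρ η ↔ ⟦ φ ⟧ ρ′ η′
  ⟦sub⟧ (s ≐ t) h g = ≡⇒↔ (cong₂ _≡_ (val-sub h s) (val-sub h t))
  ⟦sub⟧ (t ∈ X) h g = ≡⇒↔ (cong₂ _∋_ (g X) (val-sub h t))
  ⟦sub⟧ ⊥       h g = ↔-refl
  ⟦sub⟧ (φ ∧ ψ) h g = ×-cong (⟦sub⟧ φ h g) (⟦sub⟧ ψ h g)
  ⟦sub⟧ (φ ∨ ψ) h g = ¬¬⊎-cong (⟦sub⟧ φ h g) (⟦sub⟧ ψ h g)
  ⟦sub⟧ (φ ⇒ ψ) h g = →-cong (⟦sub⟧ φ h g) (⟦sub⟧ ψ h g)
  ⟦sub⟧ (∀¹ φ) {σ} h g = Π-cong λ x → ⟦sub⟧ φ (λ { zero → refl ; (suc i) → trans (val-wk (σ i)) (h i) }) g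
  ⟦sub⟧ (∃¹ φ) {σ} h g = ¬¬∃-cong λ x → ⟦sub⟧ φ (λ { zero → refl ; (suc i) → trans (val-wk (σ i)) (h i) }) g
  ⟦sub⟧ (∀² φ) h g = Π-cong λ X → ⟦sub⟧ φ h λ { zero → refl ; (suc i) → g i }
  ⟦sub⟧ (∃² φ) h g = ¬¬∃-cong λ X → ⟦sub⟧ φ h λ { zero → refl ; (suc i) → g i }

  ⟦[]¹⟧ : ∀ {n m} (φ : Formula (suc n) m) t {ρ η} → ⟦ φ [ t ]¹ ⟧ ρ η ↔ ⟦ φ ⟧ (val t ρ ▹ ρ) η
  ⟦[]¹⟧ φ t = ⟦sub⟧ φ (λ { zero → refl ; (suc i) → refl }) λ _ → refl

  ⟦[]²⟧ : ∀ {n m} (φ : Formula n (suc m)) X {ρ η} → ⟦ φ [ X ]² ⟧ ρ η ↔ ⟦ φ ⟧ ρ (η X ▹ η)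
  ⟦[]²⟧ φ X = ⟦sub⟧ φ (λ _ → refl) λ { zero → refl ; (suc i) → refl }

  ⟦wk¹⟧ : ∀ {n m} (φ : Formula n m) {x ρ η} → ⟦ wk¹ φ ⟧ (x ▹ ρ) η ↔ ⟦ φ ⟧ ρ η
  ⟦wk¹⟧ φ = ⟦sub⟧ φ (λ _ → refl) λ _ → refl

  ⟦wk²⟧ : ∀ {n m} (φ : Formula n m) {X ρ η} → ⟦ wk² φ ⟧ ρ (X ▹ η) ↔ ⟦ φ ⟧ ρ η
  ⟦wk²⟧ φ = ⟦sub⟧ φ (λ _ → refl) λ _ → refl

  ⊨_ : Sentence → Set
  ⊨ σ = ⟦ σ ⟧ (λ ()) (λ ())

  ⟦close¹⟧ : ∀ {n m} (φ : Formula n m) {η} → (∀ ρ → ⟦ φ ⟧ ρ η) → ∀ ρ → ⟦ close¹ φ ⟧ ρ η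
  ⟦close¹⟧ {zero}  φ h = h
  ⟦close¹⟧ {suc n} φ h = ⟦close¹⟧ (∀¹ φ) λ ρ x → h (x ▹ ρ)

  ⟦close²⟧ : ∀ {n m} (φ : Formula n m) {ρ} → (∀ η → ⟦ φ ⟧ ρ η) → ∀ η → ⟦ close² φ ⟧ ρ η
  ⟦close²⟧ {m = zero}  φ h = h
  ⟦close²⟧ {m = suc m} φ h = ⟦close²⟧ (∀² φ) λ η X → h (X ▹ η)

  ⊨closure : ∀ {n m} (φ : Formula n m) → (∀ ρ η → ⟦ φ ⟧ ρ η) → ⊨ closure φ
  ⊨closure φ h = ⟦close²⟧ (close¹ φ) (λ η → ⟦close¹⟧ φ (λ ρ → h ρ η) _) _

  sound : ∀ {T} → (∀ {σ} → T σ → ⊨ σ) → ∀ {n m} {Γ : List (Formula n m)} {φ} → T ▸ Γ ⊢ φ →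
          ∀ {ρ η} → (∀ {ψ} → ψ ∈ˡ Γ → ⟦ ψ ⟧ ρ η) → ⟦ φ ⟧ ρ η
  sound {T} M = go
    where
    _,,_ : ∀ {n m} {Γ : List (Formula n m)} {φ ρ η} → ⟦ φ ⟧ ρ η → (∀ {ψ} → ψ ∈ˡ Γ → ⟦ ψ ⟧ ρ η) →
           ∀ {ψ} → ψ ∈ˡ φ ∷ Γ → ⟦ ψ ⟧ ρ η
    (a ,, γ) (here refl) = a
    (a ,, γ) (there i)   = γ i

    ↑¹ : ∀ {n m} {Γ : List (Formula n m)} {ρ η} x → (∀ {ψ} → ψ ∈ˡ Γ → ⟦ ψ ⟧ ρ η) →
         ∀ {ψ} → ψ ∈ˡ map wk¹ Γ → ⟦ ψ ⟧ (x ▹ ρ) η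
    ↑¹ x γ i with ∈-map⁻ wk¹ i
    ... | ψ , j , refl = proj₂ (⟦wk¹⟧ ψ) (γ j)

    ↑² : ∀ {n m} {Γ : List (Formula n m)} {ρ η} X → (∀ {ψ} → ψ ∈ˡ Γ → ⟦ ψ ⟧ ρ η) →
         ∀ {ψ} → ψ ∈ˡ map wk² Γ → ⟦ ψ ⟧ ρ (X ▹ η)
    ↑² X γ i with ∈-map⁻ wk² i
    ... | ψ , j , refl = proj₂ (⟦wk²⟧ ψ) (γ j)

    go : ∀ {n m} {Γ : List (Formula n m)} {φ} → T ▸ Γ ⊢ φ →
         ∀ {ρ η} → (∀ {ψ} → ψ ∈ˡ Γ → ⟦ ψ ⟧ ρ η) → ⟦ φ ⟧ ρ η
    go (axiom {σ} a) γ = proj₂ (⟦sub⟧ σ (λ ()) λ ()) (M a)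
    go (hyp i) γ = γ i
    go (raa {φ} d) γ = ⟦⟧-stable φ λ k → go d (k ,, γ)
    go (⇒I d) γ = λ a → go d (a ,, γ)
    go (⇒E d e) γ = go d γ (go e γ)
    go (∧I d e) γ = go d γ , go e γ
    go (∧E₁ d) γ = proj₁ (go d γ)
    go (∧E₂ d) γ = proj₂ (go d γ)
    go (∨I₁ d) γ = λ k → k (inj₁ (go d γ))
    go (∨I₂ d) γ = λ k → k (inj₂ (go d γ))
    go (∨E {χ = χ} d e f) γ = ⟦⟧-stable χ λ k → go d γ λ
      { (inj₁ a) → k (go e (a ,, γ)) ; (inj₂ b) → k (go f (b ,, γ)) }
    go (∀¹I d) γ = λ x → go d (↑¹ x γ)
    go (∀¹E {φ} d t) γ = proj₂ (⟦[]¹⟧ φ t) (go d γ _)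
    go (∃¹I {φ} t d) γ = λ k → k (_ , proj₁ (⟦[]¹⟧ φ t) (go d γ))
    go (∃¹E {χ = χ} d e) γ = ⟦⟧-stable χ λ k → go d γ λ
      { (x , a) → k (proj₁ (⟦wk¹⟧ χ) (go e (a ,, ↑¹ x γ))) }
    go (∀²I d) γ = λ X → go d (↑² X γ)
    go (∀²E {φ} d X) γ = proj₂ (⟦[]²⟧ φ X) (go d γ _)
    go (∃²I {φ} X d) γ = λ k → k (_ , proj₁ (⟦[]²⟧ φ X) (go d γ))
    go (∃²E {χ = χ} d e) γ = ⟦⟧-stable χ λ k → go d γ λ
      { (X , a) → k (proj₁ (⟦wk²⟧ χ) (go e (a ,, ↑² X γ))) }
    go set γ = λ k → k (index , id)
    go ≐I γ = refl
    go (≐E {s} {t} φ d e) {ρ} {η} γ = proj₂ (⟦[]¹⟧ φ t)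
      (subst (λ x → ⟦ φ ⟧ (x ▹ ρ) η) (go d γ) (proj₁ (⟦[]¹⟧ φ s) (go e γ)))

  -- The number sort is standard, so induction holds for formulas of any complexity, which covers
  -- both induction schemes at once.
  ⊨Induction : ∀ {n m} (φ : Formula (suc n) m) → ⊨ Induction φ
  ⊨Induction φ = ⊨closure (φ [ 𝟎 ]¹ ∧ ∀¹ (φ ⇒ sub (v₀ ⊕ 𝟏 ▹ (var ∘ suc)) id φ) ⇒ ∀¹ φ) induct
    where
    induct : ∀ ρ η → ⟦ φ [ 𝟎 ]¹ ∧ ∀¹ (φ ⇒ sub (v₀ ⊕ 𝟏 ▹ (var ∘ suc)) id φ) ⇒ ∀¹ φ ⟧ ρ η
    induct ρ η (z , s) zero    = proj₁ (⟦[]¹⟧ φ 𝟎) z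
    induct ρ η (z , s) (suc x) = proj₁ (⟦sub⟧ φ (λ { zero → +-comm x 1 ; (suc i) → refl }) λ _ → refl)
                                       (s x (induct ρ η (z , s) x))

  ⟦≼⟧ : ∀ {n m} (s t : Term n) ρ (η : Vector Index m) → ⟦ s ≼ t ⟧ ρ η ↔ val s ρ ≤ val t ρ
  ⟦≼⟧ s t ρ η = (λ k → decidable-stable (_ ≤? _) (¬¬-map to k)) , from
    where
    to : (∃[ w ] w + val (wkT s) (w ▹ ρ) ≡ val (wkT t) (w ▹ ρ)) → val s ρ ≤ val t ρ
    to (w , e) = subst₂ _≤_ (val-wk s) (trans e (val-wk t)) (m≤n+m _ w)

    from : val s ρ ≤ val t ρ → ⟦ s ≼ t ⟧ ρ η
    from l k = k (w , trans (cong (w +_) (val-wk s)) (trans (m∸n+n≡m l) (sym (val-wk t))))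
      where w = val t ρ ∸ val s ρ

  ⟦≺⟧ : ∀ {n m} (s t : Term n) ρ (η : Vector Index m) → ⟦ s ≺ t ⟧ ρ η ↔ val s ρ < val t ρ
  ⟦≺⟧ s t ρ η = ↔-trans (⟦≼⟧ (s ⊕ 𝟏) t ρ η) (≡⇒↔ (cong (_≤ val t ρ) (+-comm (val s ρ) 1)))

  ⟦∀≺⟧ : ∀ {n m} t (φ : Formula (suc n) m) {ρ η} →
         ⟦ ∀¹ (v₀ ≺ wkT t ⇒ φ) ⟧ ρ η ↔ (∀ x → x < val t ρ → ⟦ φ ⟧ (x ▹ ρ) η)
  ⟦∀≺⟧ t φ {ρ} {η} = Π-cong λ x → →-cong
    (↔-trans (⟦≺⟧ v₀ (wkT t) (x ▹ ρ) η) (≡⇒↔ (cong (x <_) (val-wk t)))) ↔-refl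

  ⟦∃≺⟧ : ∀ {n m} t (φ : Formula (suc n) m) {ρ η} →
         ⟦ ∃¹ (v₀ ≺ wkT t ∧ φ) ⟧ ρ η ↔ ¬ ¬ (∃[ x ] x < val t ρ × ⟦ φ ⟧ (x ▹ ρ) η)
  ⟦∃≺⟧ t φ {ρ} {η} = ¬¬∃-cong λ x → ×-cong
    (↔-trans (⟦≺⟧ v₀ (wkT t) (x ▹ ρ) η) (≡⇒↔ (cong (x <_) (val-wk t)))) ↔-refl

  ⟦Bit⟧ : ∀ {n m} (s t : Term n) ρ (η : Vector Index m) →
          ⟦ Bit s t ⟧ ρ η ↔ bit (val s ρ) (val t ρ)
  ⟦Bit⟧ s t ρ η = to , λ h k → k (digit h)
    where
    to : ⟦ Bit s t ⟧ ρ η → bit (val s ρ) (val t ρ)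
    to k = bit-stable (val s ρ) λ h → k λ { (a , l) → l λ { (b , b< , e) → h (digit⇒bit (val s ρ) a
      (subst (b <_) (cong (2 **_) (val-wk₂ s)) (proj₁ (⟦≺⟧ v₀ (exp (wkT (wkT s))) (b ▹ (a ▹ ρ)) η) b<))
      (trans (sym (val-wk₂ t)) (trans e (cong (λ x → (a + a + 1) * 2 ** x + b) (val-wk₂ s))))) } }

    digit : bit (val s ρ) (val t ρ) → ∃[ a ] ¬ ¬ (∃[ b ]
            ⟦ v₀ ≺ exp (wkT (wkT s)) ∧ wkT (wkT t) ≐ (v₁ ⊕ v₁ ⊕ 𝟏) ⊗ exp (wkT (wkT s)) ⊕ v₀ ⟧ (b ▹ (a ▹ ρ)) η)
    digit h with bit⇒digit (val s ρ) h
    ... | a , b , b< , e = a , λ k → k (b ,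
      proj₂ (⟦≺⟧ v₀ (exp (wkT (wkT s))) (b ▹ (a ▹ ρ)) η) (subst (b <_) (sym (cong (2 **_) (val-wk₂ s))) b<) ,
      trans (val-wk₂ t) (trans e (cong (λ x → (a + a + 1) * 2 ** x + b) (sym (val-wk₂ s)))))

-- Compactness and the arithmetical basis theorem

record Real : Set₁ where
  constructor real
  field
    at        : ℕ → Set
    at-stable : ∀ {x} → ¬ ¬ at x → at x

open Real

bits : ℕ → ℕ → Set
bits c i = bit i c

digits : ℕ → Real
digits c = real (bits c) λ {i} → bit-stable i

infix 4 _≈[_]_

_≈[_]_ : (ℕ → Set) → ℕ → (ℕ → Set) → Set
V ≈[ ℓ ] U = ∀ i → i < ℓ → V i ↔ U i

≈-sym : ∀ {V ℓ U} → V ≈[ ℓ ] U → U ≈[ ℓ ] V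
≈-sym e i h = ↔-sym (e i h)

≈-trans : ∀ {V ℓ U T} → V ≈[ ℓ ] U → U ≈[ ℓ ] T → V ≈[ ℓ ] T
≈-trans e f i h = ↔-trans (e i h) (f i h)

≈-mono : ∀ {V ℓ ℓ′ U} → ℓ ≤ ℓ′ → V ≈[ ℓ′ ] U → V ≈[ ℓ ] U
≈-mono h e i i< = e i (<-≤-trans i< h)

-- The leftmost solution W of a sequence of conditions, each depending on
-- finitely many values only; by compactness it suffices that they are finitely
-- satisfiable. W takes the value 1 at i only if no finite extensions of W ↾ i
-- with value 0 at i satisfy arbitrarily many of the conditions.
module Leftmost
  (Holds : ℕ → Real → Set)
  (Holds-stable : ∀ {n V} → ¬ ¬ Holds n V → Holds n V)
  (local : ∀ n → ∃[ b ] ∀ V U → at V ≈[ b ] at U → Holds n V → Holds n U)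
  (solution : ℕ → Real)
  (solves : ∀ N n → n < N → Holds n (solution N))
  where

  Upto : ℕ → Real → Set
  Upto N V = ∀ n → n < N → Holds n V

  -- A finite extension is one number c, read as the finite set of positions of its digits 1. The
  -- quantifiers thus range over numbers, which keeps the definition arithmetical.
  Avoids : (ℕ → Set) → ℕ → Set
  Avoids V i = ∀ N → ¬ ¬ (∃[ c ] bits c ≈[ i ] V × ¬ bit i c × Upto N (digits c))

  Avoids-cong : ∀ {V i U} → V ≈[ i ] U → Avoids V i → Avoids U i
  Avoids-cong e a N = ¬¬-map (λ { (c , f , h) → c , ≈-trans f e , h }) (a N)

  -- A course of values in one number: the requirement at i depends on s below i only. Quantifying
  -- over s turns the recursion that defines `W` into an explicit formula.
  Leftmost : ℕ → ℕ → Set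
  Leftmost s ℓ = ∀ i → i < ℓ → bit i s ↔ ¬ Avoids (bits s) i

  leftmost-unique : ∀ ℓ {s s′} → Leftmost s ℓ → Leftmost s′ ℓ → bits s ≈[ ℓ ] bits s′
  leftmost-unique (suc ℓ) {s} {s′} p q i i< with m<1+n⇒m<n∨m≡n i<
  ... | inj₁ i<ℓ = leftmost-unique ℓ (λ j h → p j (m<n⇒m<1+n h)) (λ j h → q j (m<n⇒m<1+n h)) i i<ℓ
  ... | inj₂ refl = ↔-trans (p i i<) (↔-trans (¬-cong (Avoids-cong e , Avoids-cong (≈-sym e))) (↔-sym (q i i<)))
    where
    e : bits s ≈[ i ] bits s′
    e = leftmost-unique i (λ j h → p j (m<n⇒m<1+n h)) (λ j h → q j (m<n⇒m<1+n h))

  leftmost-exists : ∀ ℓ → ¬ ¬ (∃[ s ] Leftmost s ℓ)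
  leftmost-exists zero    k = k (0 , λ _ ())
  leftmost-exists (suc ℓ) k = leftmost-exists ℓ λ { (s , p) →
    ¬¬-prefix (λ i → (i < ℓ → bit i s) × (i ≡ ℓ → ¬ Avoids (bits s) ℓ)) (suc ℓ) λ { (s′ , _ , e) →
    let agree : bits s ≈[ ℓ ] bits s′
        agree i h = ↔-trans ((λ b → (λ _ → b) , λ i≡ℓ → contradiction i≡ℓ (<⇒≢ h)) , λ u → proj₁ u h)
                            (↔-sym (e i (m<n⇒m<1+n h)))
    in k (s′ , λ i i< → case m<1+n⇒m<n∨m≡n i< of λ
      { (inj₁ h) → ↔-trans (≈-sym agree i h) (↔-trans (p i h)
          (¬-cong (Avoids-cong (≈-mono (<⇒≤ h) agree) , Avoids-cong (≈-sym (≈-mono (<⇒≤ h) agree)))))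
      ; (inj₂ refl) → ↔-trans (e i i<) (↔-trans
          ((λ u → proj₂ u refl) , λ a → (λ h → contradiction h (n≮n i)) , λ _ → a)
          (¬-cong (Avoids-cong agree , Avoids-cong (≈-sym agree)))) }) } }

  W : Real
  at        W x = ¬ ¬ (∃[ s ] Leftmost s (suc x) × bit x s)
  at-stable W k h = k λ u → u h

  leftmost-prefix : ∀ {s ℓ} → Leftmost s ℓ → bits s ≈[ ℓ ] at W
  leftmost-prefix {s} p i i< = (λ b k → k (s , below , b)) ,
    λ w → bit-stable i λ k → w λ { (s′ , q , b) → k (proj₁ (leftmost-unique (suc i) q below i ≤-refl) b) }
    where
    below : Leftmost s (suc i)
    below j h = p j (<-≤-trans h i<)

  W-avoids : ∀ i → at W i ↔ ¬ Avoids (at W) i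
  W-avoids i =
    (λ w a → leftmost-exists (suc i) λ { (s , p) →
      proj₁ (equiv p) w (Avoids-cong (≈-sym (≈-mono (n≤1+n i) (leftmost-prefix p))) a) }) ,
    λ a → at-stable W λ k → leftmost-exists (suc i) λ { (s , p) →
      k (proj₂ (equiv p) (a ∘ Avoids-cong (≈-mono (n≤1+n i) (leftmost-prefix p)))) }
    where
    equiv : ∀ {s} → Leftmost s (suc i) → at W i ↔ ¬ Avoids (bits s) i
    equiv p = ↔-trans (↔-sym (leftmost-prefix p i ≤-refl)) (p i ≤-refl)

  Approximates : ℕ → ℕ → ℕ → Set
  Approximates ℓ N c = bits c ≈[ ℓ ] at W × Upto N (digits c)

  local-upto : ∀ N → ∃[ b ] ∀ V U → at V ≈[ b ] at U → Upto N V → Upto N U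
  local-upto zero    = 0 , λ _ _ _ _ _ ()
  local-upto (suc N) with local-upto N | local N
  ... | b , f | b′ , g = b ⊔ b′ , λ V U e h n n< → case m<1+n⇒m<n∨m≡n n< of λ
    { (inj₁ n<N) → f V U (≈-mono (m≤m⊔n b b′) e) (λ i i< → h i (m<n⇒m<1+n i<)) n n<N
    ; (inj₂ refl) → g V U (≈-mono (m≤n⊔m b b′) e) (h n n<) }

  -- Induction on ℓ. If `Avoids` fails at ℓ, there is an M such that no c with digit 0 at ℓ solves
  -- the first M conditions; an approximation that solves the first N ⊔ M then has digit 1 there, as
  -- `W` does.
  approximation : ∀ ℓ N → ¬ ¬ (∃[ c ] Approximates ℓ N c)
  -- Compactness: `solution N` may be infinite, but the first N conditions see it only below a
  -- common bound b, so a number with the same digits below b solves them too.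
  approximation zero N k with local-upto N
  ... | b , f = ¬¬-prefix (at (solution N)) b λ { (c , _ , e) →
    k (c , (λ _ ()) , f (solution N) (digits c) (≈-sym e) (solves N)) }
  approximation (suc ℓ) N k = ¬¬-excluded-middle λ
    { (yes a) → a N λ { (c , e , b , u) → k (c , extend e (λ w → proj₁ (W-avoids ℓ) w a) b , u) }
    ; (no ¬a) → ¬a λ M h → approximation ℓ (N ⊔ M) λ { (c , e , u) → ¬¬-excluded-middle λ
        { (no b)  → h (c , e , b , λ n n< → u n (<-≤-trans n< (m≤n⊔m N M)))
        ; (yes b) → k (c , extend′ e b (proj₂ (W-avoids ℓ) ¬a) , λ n n< → u n (<-≤-trans n< (m≤m⊔n N M))) } } }
    where
    extend : ∀ {c} → bits c ≈[ ℓ ] at W → ¬ at W ℓ → ¬ bit ℓ c → bits c ≈[ suc ℓ ] at W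
    extend e w b i i< with m<1+n⇒m<n∨m≡n i<
    ... | inj₁ h = e i h
    ... | inj₂ refl = (λ x → contradiction x b) , λ x → contradiction x w
    extend′ : ∀ {c} → bits c ≈[ ℓ ] at W → bit ℓ c → at W ℓ → bits c ≈[ suc ℓ ] at W
    extend′ e b w i i< with m<1+n⇒m<n∨m≡n i<
    ... | inj₁ h = e i h
    ... | inj₂ refl = (λ _ → w) , λ _ → b

  W-solves : ∀ n → Holds n W
  W-solves n with local n
  ... | b , f = Holds-stable λ k → approximation b (suc n) λ { (c , e , u) →
    k (f (digits c) W e (u n ≤-refl)) }

-- Bounded formulas as conditions on a single set

Δ⁰₀⇒Arithmetical : ∀ {n m} {φ : Formula n m} → Δ⁰₀ φ → Arithmetical φ
Δ⁰₀⇒Arithmetical (s ≐ t)  = s ≐ t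
Δ⁰₀⇒Arithmetical (t ∈ X)  = t ∈ X
Δ⁰₀⇒Arithmetical ⊥        = ⊥
Δ⁰₀⇒Arithmetical (φ ∧ ψ)  = Δ⁰₀⇒Arithmetical φ ∧ Δ⁰₀⇒Arithmetical ψ
Δ⁰₀⇒Arithmetical (φ ∨ ψ)  = Δ⁰₀⇒Arithmetical φ ∨ Δ⁰₀⇒Arithmetical ψ
Δ⁰₀⇒Arithmetical (φ ⇒ ψ)  = Δ⁰₀⇒Arithmetical φ ⇒ Δ⁰₀⇒Arithmetical ψ
Δ⁰₀⇒Arithmetical (∀≺ t φ) = ∀¹ (∃¹ (_ ≐ _) ⇒ Δ⁰₀⇒Arithmetical φ)
Δ⁰₀⇒Arithmetical (∃≺ t φ) = ∃¹ (∃¹ (_ ≐ _) ∧ Δ⁰₀⇒Arithmetical φ)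

Bit-arithmetical : ∀ {n m} (s t : Term n) → Arithmetical (Bit {m = m} s t)
Bit-arithmetical s t = ∃¹ (∃¹ (∃¹ (_ ≐ _) ∧ _ ≐ _))

single : Real → ωStructure
single V = record { Index = Unit ; _∋_ = λ _ → at V ; stable = at-stable V ; index = tt }

sat : ∀ {n m} → Formula n m → Vector ℕ n → Real → Set
sat φ ρ V = Satisfaction.⟦_⟧ (single V) φ ρ (λ _ → tt)

sat-stable : ∀ {n m} (φ : Formula n m) {ρ V} → ¬ ¬ sat φ ρ V → sat φ ρ V
sat-stable φ {V = V} = Satisfaction.⟦⟧-stable (single V) φ

sup : (ℕ → ℕ) → ℕ → ℕ
sup f zero    = 0
sup f (suc m) = sup f m ⊔ f m

≤-sup : ∀ f {m x} → x < m → f x ≤ sup f m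
≤-sup f {suc m} x< with m<1+n⇒m<n∨m≡n x<
... | inj₁ h    = ≤-trans (≤-sup f h) (m≤m⊔n _ _)
... | inj₂ refl = m≤n⊔m (sup f m) _

-- The use of the formula in the sense of computability theory: a strict bound on the numbers whose
-- membership is consulted. It exists because all quantifiers are bounded.
modulus : ∀ {n m} {φ : Formula n m} → Δ⁰₀ φ → Vector ℕ n → ℕ
modulus (s ≐ t)  ρ = 0
modulus (t ∈ X)  ρ = suc (val t ρ)
modulus ⊥        ρ = 0
modulus (φ ∧ ψ)  ρ = modulus φ ρ ⊔ modulus ψ ρ
modulus (φ ∨ ψ)  ρ = modulus φ ρ ⊔ modulus ψ ρ
modulus (φ ⇒ ψ)  ρ = modulus φ ρ ⊔ modulus ψ ρ
modulus (∀≺ t φ) ρ = sup (λ x → modulus φ (x ▹ ρ)) (val t ρ)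
modulus (∃≺ t φ) ρ = sup (λ x → modulus φ (x ▹ ρ)) (val t ρ)

sat-local : ∀ {n m} {φ : Formula n m} (δ : Δ⁰₀ φ) {ρ} V U → at V ≈[ modulus δ ρ ] at U → sat φ ρ V ↔ sat φ ρ U
sat-local (s ≐ t) V U e = ↔-refl
sat-local (t ∈ X) V U e = e _ ≤-refl
sat-local ⊥       V U e = ↔-refl
sat-local (φ ∧ ψ) V U e =
  ×-cong (sat-local φ V U (≈-mono (m≤m⊔n _ _) e)) (sat-local ψ V U (≈-mono (m≤n⊔m _ _) e))
sat-local (φ ∨ ψ) V U e =
  ¬¬⊎-cong (sat-local φ V U (≈-mono (m≤m⊔n _ _) e)) (sat-local ψ V U (≈-mono (m≤n⊔m _ _) e))
sat-local (φ ⇒ ψ) V U e =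
  →-cong (sat-local φ V U (≈-mono (m≤m⊔n _ _) e)) (sat-local ψ V U (≈-mono (m≤n⊔m _ _) e))
sat-local (∀≺ t {φ} δ) {ρ} V U e =
  ↔-trans (Satisfaction.⟦∀≺⟧ (single V) t φ) (↔-trans
    (Π-cong λ x → (λ f x< → proj₁ (body x<) (f x<)) , λ f x< → proj₂ (body x<) (f x<))
    (↔-sym (Satisfaction.⟦∀≺⟧ (single U) t φ)))
  where
  body : ∀ {x} → x < val t ρ → sat φ (x ▹ ρ) V ↔ sat φ (x ▹ ρ) U
  body x< = sat-local δ V U (≈-mono (≤-sup (λ x → modulus δ (x ▹ ρ)) x<) e)
sat-local (∃≺ t {φ} δ) {ρ} V U e =
  ↔-trans (Satisfaction.⟦∃≺⟧ (single V) t φ) (↔-trans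
    (¬¬∃-cong λ x → (λ (x< , h) → x< , proj₁ (body x<) h) , λ (x< , h) → x< , proj₂ (body x<) h)
    (↔-sym (Satisfaction.⟦∃≺⟧ (single U) t φ)))
  where
  body : ∀ {x} → x < val t ρ → sat φ (x ▹ ρ) V ↔ sat φ (x ▹ ρ) U
  body x< = sat-local δ V U (≈-mono (≤-sup (λ x → modulus δ (x ▹ ρ)) x<) e)

-- The values at set quantifiers are junk.
inst : ∀ {n n′} → Vector (Term n′) n → Term n′ → Formula n 1 → Formula n′ 0
inst τ c (s ≐ t) = subT τ s ≐ subT τ t
inst τ c (t ∈ X) = Bit (subT τ t) c
inst τ c ⊥       = ⊥
inst τ c (φ ∧ ψ) = inst τ c φ ∧ inst τ c ψ
inst τ c (φ ∨ ψ) = inst τ c φ ∨ inst τ c ψ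
inst τ c (φ ⇒ ψ) = inst τ c φ ⇒ inst τ c ψ
inst τ c (∀¹ φ)  = ∀¹ (inst (v₀ ▹ (wkT ∘ τ)) (wkT c) φ)
inst τ c (∃¹ φ)  = ∃¹ (inst (v₀ ▹ (wkT ∘ τ)) (wkT c) φ)
inst τ c (∀² φ)  = ⊥
inst τ c (∃² φ)  = ⊥

inst-arithmetical : ∀ {n n′} (τ : Vector (Term n′) n) c φ → Arithmetical (inst τ c φ)
inst-arithmetical τ c (s ≐ t) = _ ≐ _
inst-arithmetical τ c (t ∈ X) = Bit-arithmetical (subT τ t) c
inst-arithmetical τ c ⊥       = ⊥
inst-arithmetical τ c (φ ∧ ψ) = inst-arithmetical τ c φ ∧ inst-arithmetical τ c ψ
inst-arithmetical τ c (φ ∨ ψ) = inst-arithmetical τ c φ ∨ inst-arithmetical τ c ψ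
inst-arithmetical τ c (φ ⇒ ψ) = inst-arithmetical τ c φ ⇒ inst-arithmetical τ c ψ
inst-arithmetical τ c (∀¹ φ)  = ∀¹ (inst-arithmetical _ _ φ)
inst-arithmetical τ c (∃¹ φ)  = ∃¹ (inst-arithmetical _ _ φ)
inst-arithmetical τ c (∀² φ)  = ⊥
inst-arithmetical τ c (∃² φ)  = ⊥

module _ (𝔐 : ωStructure) where
  open Satisfaction 𝔐

  ⟦inst⟧ : ∀ {n n′} {φ : Formula n 1} → Arithmetical φ → ∀ {τ : Vector (Term n′) n} {c ρ ρ′ x η} →
           (∀ i → val (τ i) ρ ≡ ρ′ i) → val c ρ ≡ x → ⟦ inst τ c φ ⟧ ρ η ↔ sat φ ρ′ (digits x)
  ⟦inst⟧ (s ≐ t) h g = ≡⇒↔ (cong₂ _≡_ (val-sub h s) (val-sub h t))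
  ⟦inst⟧ (t ∈ X) {τ} {c} {ρ} {η = η} h g = ↔-trans (⟦Bit⟧ (subT τ t) c ρ η) (≡⇒↔ (cong₂ bit (val-sub h t) g))
  ⟦inst⟧ ⊥       h g = ↔-refl
  ⟦inst⟧ (φ ∧ ψ) h g = ×-cong (⟦inst⟧ φ h g) (⟦inst⟧ ψ h g)
  ⟦inst⟧ (φ ∨ ψ) h g = ¬¬⊎-cong (⟦inst⟧ φ h g) (⟦inst⟧ ψ h g)
  ⟦inst⟧ (φ ⇒ ψ) h g = →-cong (⟦inst⟧ φ h g) (⟦inst⟧ ψ h g)
  ⟦inst⟧ (∀¹ φ) {τ} {c} h g = Π-cong λ x →
    ⟦inst⟧ φ (λ { zero → refl ; (suc i) → trans (val-wk (τ i)) (h i) }) (trans (val-wk c) g)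
  ⟦inst⟧ (∃¹ φ) {τ} {c} h g = ¬¬∃-cong λ x →
    ⟦inst⟧ φ (λ { zero → refl ; (suc i) → trans (val-wk (τ i)) (h i) }) (trans (val-wk c) g)

module ArithmeticalBasis
  {C : Formula 1 1} (δ : Δ⁰₀ C) (solution : ℕ → Real)
  (solves : ∀ N n → n < N → sat C (λ _ → n) (solution N))
  where

  open Leftmost (λ n → sat C (λ _ → n)) (λ {n} {V} → sat-stable C {V = V})
    (λ n → modulus δ (λ _ → n) , λ V U e → proj₁ (sat-local δ V U e)) solution solves public

  avoids : ∀ {n} → Term n → Term n → Formula n 0
  avoids s i = ∀¹ (∃¹
    (∀¹ (v₀ ≺ wkT (wkT (wkT i)) ⇒ (Bit v₀ v₁ ⇔ Bit v₀ (wkT (wkT (wkT s))))) ∧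
     ∼ Bit (wkT (wkT i)) v₀ ∧
     ∀¹ (v₀ ≺ var (# 2) ⇒ inst (λ _ → v₀) v₁ C)))

  defining : Formula 1 0
  defining = ∃¹ (∀¹ (v₀ ≺ var (# 2) ⊕ 𝟏 ⇒ (Bit v₀ v₁ ⇔ ∼ avoids v₁ v₀)) ∧ Bit v₁ v₀)

  defining-arithmetical : Arithmetical defining
  defining-arithmetical = ∃¹ (∀¹ (∃¹ (_ ≐ _) ⇒ iff (Bit-arithmetical v₀ v₁)
    (∀¹ (∃¹ (∀¹ (∃¹ (_ ≐ _) ⇒ iff (Bit-arithmetical v₀ v₁) (Bit-arithmetical _ _)) ∧
      (Bit-arithmetical _ v₀ ⇒ ⊥) ∧ ∀¹ (∃¹ (_ ≐ _) ⇒ inst-arithmetical _ _ C))) ⇒ ⊥)) ∧ Bit-arithmetical v₁ v₀)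
    where
    iff : ∀ {n m} {φ ψ : Formula n m} → Arithmetical φ → Arithmetical ψ → Arithmetical (φ ⇔ ψ)
    iff φ ψ = (φ ⇒ ψ) ∧ (ψ ⇒ φ)

  module _ (𝔐 : ωStructure) where
    open Satisfaction 𝔐

    ⟦≺⟧′ : ∀ {n m} (s t : Term n) ρ (η : Vector (ωStructure.Index 𝔐) m) {x} → val t ρ ≡ x →
            ⟦ s ≺ t ⟧ ρ η ↔ val s ρ < x
    ⟦≺⟧′ s t ρ η refl = ⟦≺⟧ s t ρ η

    ⟦Bit⟧′ : ∀ {n m} (s t : Term n) ρ (η : Vector (ωStructure.Index 𝔐) m) {x y} →
              val s ρ ≡ x → val t ρ ≡ y → ⟦ Bit s t ⟧ ρ η ↔ bit x y
    ⟦Bit⟧′ s t ρ η refl refl = ⟦Bit⟧ s t ρ η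

    ⟦avoids⟧ : ∀ {n} (s i : Term n) ρ η → ⟦ avoids s i ⟧ ρ η ↔ Avoids (bits (val s ρ)) (val i ρ)
    ⟦avoids⟧ s i ρ η = Π-cong λ N → ¬¬∃-cong λ c → ×-cong
      (Π-cong λ j → let ρ′ = j ▹ (c ▹ (N ▹ ρ)) in →-cong (⟦≺⟧′ v₀ (wkT (wkT (wkT i))) ρ′ η (val-wk₃ i))
        (⇔-cong (⟦Bit⟧ v₀ v₁ ρ′ η) (⟦Bit⟧′ v₀ (wkT (wkT (wkT s))) ρ′ η refl (val-wk₃ s))))
      (×-cong (¬-cong (⟦Bit⟧′ (wkT (wkT i)) v₀ (c ▹ (N ▹ ρ)) η (val-wk₂ i) refl))
        (Π-cong λ n → let ρ′ = n ▹ (c ▹ (N ▹ ρ)) in →-cong (⟦≺⟧ v₀ (var (# 2)) ρ′ η)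
          (⟦inst⟧ 𝔐 (Δ⁰₀⇒Arithmetical δ) {ρ = ρ′} {η = η} (λ _ → refl) refl)))
      where
      val-wk₃ : ∀ (u : Term _) {x y z} → val (wkT (wkT (wkT u))) (x ▹ (y ▹ (z ▹ ρ))) ≡ val u ρ
      val-wk₃ u = trans (val-wk (wkT (wkT u))) (val-wk₂ u)

    -- The formula contains no sets at all, so it has the same meaning in every ω-structure. In
    -- particular it defines `W` inside the model that is built from `W`.
    ⟦defining⟧ : ∀ ρ η → ⟦ defining ⟧ ρ η ↔ at W (ρ zero)
    ⟦defining⟧ ρ η = ¬¬∃-cong λ s → ×-cong
      (Π-cong λ i → let ρ′ = i ▹ (s ▹ ρ) in →-cong (⟦≺⟧′ v₀ (var (# 2) ⊕ 𝟏) ρ′ η (+-comm _ 1))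
        (⇔-cong (⟦Bit⟧ v₀ v₁ ρ′ η) (¬-cong (⟦avoids⟧ v₁ v₀ ρ′ η))))
      (⟦Bit⟧ v₁ v₀ (s ▹ ρ) η)

-- Binary trees coded by numbers

-- Unlike Cantor's pairing this is a term of the language, because exponentiation is, so that
-- conditions on `W` can mention codes without quantifiers. The value 0 is never taken and is left
-- for the empty tree.
pr : ℕ → ℕ → ℕ
pr a b = 2 ** a * (b + b + 1)

n<2^n : ∀ n → n < 2 ** n
n<2^n zero    = s≤s z≤n
n<2^n (suc n) = begin-strict
  suc n            ≡⟨ +-comm 1 n ⟩
  n + 1            <⟨ +-mono-<-≤ (n<2^n n) (m^n>0 2 n) ⟩
  2 ** n + 2 ** n  ≡⟨ cong (2 ** n +_) (sym (+-identityʳ (2 ** n))) ⟩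
  2 ** suc n       ∎
  where open ≤-Reasoning

a<pr : ∀ a b → a < pr a b
a<pr a b = begin-strict
  a            <⟨ n<2^n a ⟩
  2 ** a       ≡⟨ sym (*-identityʳ (2 ** a)) ⟩
  2 ** a * 1   ≤⟨ *-monoʳ-≤ (2 ** a) (m≤n+m 1 (b + b)) ⟩
  pr a b       ∎
  where open ≤-Reasoning

b<pr : ∀ a b → b < pr a b
b<pr a b = begin-strict
  b                ≤⟨ m≤m+n b b ⟩
  b + b            <⟨ m<m+n (b + b) (s≤s z≤n) ⟩
  b + b + 1        ≡⟨ sym (*-identityˡ (b + b + 1)) ⟩
  1 * (b + b + 1)  ≤⟨ *-monoˡ-≤ (b + b + 1) (m^n>0 2 a) ⟩
  pr a b           ∎
  where open ≤-Reasoning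

pr-suc : ∀ a b → pr (suc a) b ≡ pr a b * 2
pr-suc a b = trans (*-assoc 2 (2 ** a) (b + b + 1)) (*-comm 2 (pr a b))

pr-zero : ∀ b → pr 0 b ≡ b * 2 + 1
pr-zero b = expand b
  where
  expand : ∀ b → 1 * (b + b + 1) ≡ b * 2 + 1
  expand = solve-∀

pr-injective : ∀ a b c d → pr a b ≡ pr c d → a ≡ c × b ≡ d
pr-injective zero b zero d e = refl , *-cancelʳ-≡ b d 2 (+-cancelʳ-≡ 1 (b * 2) (d * 2)
  (trans (sym (pr-zero b)) (trans e (pr-zero d))))
pr-injective zero b (suc c) d e = contradiction
  (trans (sym ([r+2q]%2 b (s≤s (s≤s z≤n)))) (trans
    (cong (_% 2) (trans (sym (pr-zero b)) (trans e (pr-suc c d)))) (m*n%n≡0 (pr c d) 2)))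
  λ ()
pr-injective (suc a) b zero d e = contradiction
  (trans (sym ([r+2q]%2 d (s≤s (s≤s z≤n)))) (trans
    (cong (_% 2) (trans (sym (pr-zero d)) (trans (sym e) (pr-suc a b)))) (m*n%n≡0 (pr a b) 2)))
  λ ()
pr-injective (suc a) b (suc c) d e with pr-injective a b c d
  (*-cancelʳ-≡ (pr a b) (pr c d) 2 (trans (sym (pr-suc a b)) (trans e (pr-suc c d))))
... | refl , refl = refl , refl

pr-surjective : ∀ n → ∃[ a ] ∃[ b ] pr a b ≡ suc n
pr-surjective = <-rec _ λ n rec → split n rec (suc n % 2) (suc n / 2) (m%n<n (suc n) 2) (m≡m%n+[m/n]*n (suc n) 2)
  where
  split : ∀ n → (∀ {m} → m < n → ∃[ a ] ∃[ b ] pr a b ≡ suc m) →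
          ∀ r q → r < 2 → suc n ≡ r + q * 2 → ∃[ a ] ∃[ b ] pr a b ≡ suc n
  split n rec zero (suc q) _ e with rec {q} (subst (q <_) (sym (suc-injective e)) (s≤s (m≤m*n q 2)))
  ... | a , b , e′ = suc a , b , trans (pr-suc a b) (trans (cong (_* 2) e′) (sym e))
  split n rec (suc zero) q _ e = 0 , q , trans (pr-zero q) (trans (+-comm (q * 2) 1) (sym e))
  split n rec (suc (suc r)) q (s≤s (s≤s ())) e

-- Every number codes exactly one tree, so a program given by an arbitrary number can be evaluated
-- by structural recursion.
data Tree : Set where
  leaf : Tree
  node : Tree → Tree → Tree

enc : Tree → ℕ
enc leaf       = 0
enc (node t u) = pr (enc t) (enc u)

enc-injective : ∀ t u → enc t ≡ enc u → t ≡ u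
enc-injective leaf leaf e = refl
enc-injective leaf (node u v) e = contradiction (subst (enc u <_) (sym e) (a<pr (enc u) (enc v))) λ ()
enc-injective (node t s) leaf e = contradiction (subst (enc t <_) e (a<pr (enc t) (enc s))) λ ()
enc-injective (node t s) (node u v) e with pr-injective (enc t) (enc s) (enc u) (enc v) e
... | e₁ , e₂ = cong₂ node (enc-injective t u e₁) (enc-injective s v e₂)

abstract
  enc-surjective : ∀ n → ∃[ t ] enc t ≡ n
  enc-surjective = <-rec _ λ
    { zero rec → leaf , refl
    ; (suc n) rec → let a , b , e = pr-surjective n
                        t , e₁ = rec {a} (subst (a <_) e (a<pr a b))
                        u , e₂ = rec {b} (subst (b <_) e (b<pr a b))
                    in node t u , trans (cong₂ pr e₁ e₂) e }

dec : ℕ → Tree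
dec n = proj₁ (enc-surjective n)

enc-dec : ∀ n → enc (dec n) ≡ n
enc-dec n = proj₂ (enc-surjective n)

dec-enc : ∀ t → dec (enc t) ≡ t
dec-enc t = enc-injective _ t (enc-dec (enc t))

onTrees : ∀ {P : ℕ → Set} → (∀ t → P (enc t)) → ∀ n → P n
onTrees {P} h n = subst P (enc-dec n) (h (dec n))

-- The stack machine

data Opcode : Set where
  const dup move back add mul pow bind eq nor ex mu path : Opcode

code : Opcode → ℕ
code const = 0
code dup   = 1
code move  = 2
code back  = 3
code add   = 4
code mul   = 5
code pow   = 6
code bind  = 7
code eq    = 8
code nor   = 9
code ex    = 10
code mu    = 11
code path  = 12

decode : ℕ → Maybe Opcode
decode 0  = just const
decode 1  = just dup
decode 2  = just move
decode 3  = just back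
decode 4  = just add
decode 5  = just mul
decode 6  = just pow
decode 7  = just bind
decode 8  = just eq
decode 9  = just nor
decode 10 = just ex
decode 11 = just mu
decode 12 = just path
decode _  = nothing

decode-code : ∀ o → decode (code o) ≡ just o
decode-code const = refl
decode-code dup   = refl
decode-code move  = refl
decode-code back  = refl
decode-code add   = refl
decode-code mul   = refl
decode-code pow   = refl
decode-code bind  = refl
decode-code eq    = refl
decode-code nor   = refl
decode-code ex    = refl
decode-code mu    = refl
decode-code path  = refl

-- The initial segment of length ℓ of the sequence coded by (a+1)·2^ℓ + q is
-- coded by 2^ℓ + q.
Prefixes : (ℕ → Set) → ℕ → Set
Prefixes T c = ∀ ℓ a q → q < 2 ** ℓ → c ≡ suc a * 2 ** ℓ + q → T (2 ** ℓ + q)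

number : (Tree → Set) → ℕ → Set
number A n = A (node leaf (node (dec n) leaf))

module _ (B : ℕ) where

  -- A longer sequence has a greater code, so the greatest c is a branch of maximal length among the
  -- codes below `B`. All prefixes are demanded because A is an arbitrary set of numbers and perhaps
  -- not a tree.
  Longest : (Tree → Set) → ℕ → Set
  Longest A c = c < B × Prefixes (number A) c × (∀ d → d < B → Prefixes (number A) d → d ≤ c)

  -- A program is ((i , j) , k) with opcode k: `A` is acceptance by the continuation i, and j is an
  -- operand, which serves as a constant in `const`, as a stack in `bind` and as a second program,
  -- with acceptance `A′`, in `nor` and `mu`. There are no jumps, as `mu` does all unbounded
  -- searching. The bound `B` truncates the trees to which `path` is applied.
  Op : Opcode → (Tree → Set) → (Tree → Set) → Tree → Tree → Set
  Op const A _ j (node s r)                   = A (node s (node j r))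
  Op dup   A _ _ (node s (node x r))          = A (node s (node x (node x r)))
  Op move  A _ _ (node s (node x r))          = A (node (node x s) r)
  Op back  A _ _ (node (node x s) (node y r)) = A (node s (node y (node x r)))
  Op add   A _ _ (node (node x s) (node y r)) = A (node s (node (dec (enc x + enc y)) r))
  Op mul   A _ _ (node (node x s) (node y r)) = A (node s (node (dec (enc x * enc y)) r))
  Op pow   A _ _ (node s (node x r))          = A (node s (node (dec (2 ** enc x)) r))
  Op bind  A _ j (node _ (node x _))          = A (node leaf (node x j))
  Op eq    _ _ _ (node (node x _) (node y _)) = enc x ≡ enc y
  Op nor   A A′ _ u                           = ¬ A u × ¬ A′ u
  Op ex    A _ _ (node s (node x r))          = ¬ ¬ (∃[ y ] y < enc x × A (node s (node (dec y) r)))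
  Op mu    A A′ _ (node s r)                  = ¬ ¬ (∃[ y ] A (node s (node (dec y) r)) ×
    (∀ z → z < y → ¬ A (node s (node (dec z) r))) × A′ (node s (node (dec y) r)))
  Op path  A _ _ (node _ (node x _))          = ¬ ¬ (∃[ c ] Longest A c × bit (enc x) c)
  Op _     _ _ _ _                            = Empty

  Sat : Tree → Tree → Set
  Sat leaf                _ = Empty
  Sat (node leaf k)       _ = Empty
  Sat (node (node i j) k) u = maybe′ (λ o → Op o (Sat i) (Sat j) j u) Empty (decode (enc k))

  Op-stable : ∀ o {A A′ j u} → (∀ {v} → ¬ ¬ A v → A v) → ¬ ¬ Op o A A′ j u → Op o A A′ j u
  Op-stable const {u = node _ _} h = h
  Op-stable const {u = leaf} h k = k id
  Op-stable dup {u = leaf} h k = k id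
  Op-stable dup {u = node _ leaf} h k = k id
  Op-stable dup {u = node _ (node _ _)} h = h
  Op-stable move {u = leaf} h k = k id
  Op-stable move {u = node _ leaf} h k = k id
  Op-stable move {u = node _ (node _ _)} h = h
  Op-stable back {u = leaf} h k = k id
  Op-stable back {u = node leaf _} h k = k id
  Op-stable back {u = node (node _ _) leaf} h k = k id
  Op-stable back {u = node (node _ _) (node _ _)} h = h
  Op-stable add {u = leaf} h k = k id
  Op-stable add {u = node leaf _} h k = k id
  Op-stable add {u = node (node _ _) leaf} h k = k id
  Op-stable add {u = node (node _ _) (node _ _)} h = h
  Op-stable mul {u = leaf} h k = k id
  Op-stable mul {u = node leaf _} h k = k id
  Op-stable mul {u = node (node _ _) leaf} h k = k id
  Op-stable mul {u = node (node _ _) (node _ _)} h = h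
  Op-stable pow {u = leaf} h k = k id
  Op-stable pow {u = node _ leaf} h k = k id
  Op-stable pow {u = node _ (node _ _)} h = h
  Op-stable bind {u = leaf} h k = k id
  Op-stable bind {u = node _ leaf} h k = k id
  Op-stable bind {u = node _ (node _ _)} h = h
  Op-stable eq {u = leaf} h k = k id
  Op-stable eq {u = node leaf _} h k = k id
  Op-stable eq {u = node (node _ _) leaf} h k = k id
  Op-stable eq {u = node (node _ _) (node _ _)} h = decidable-stable (_ ≟ᴺ _)
  Op-stable nor h k = (λ a → k (λ p → proj₁ p a)) , λ a → k (λ p → proj₂ p a)
  Op-stable ex {u = leaf} h k = k id
  Op-stable ex {u = node _ leaf} h k = k id
  Op-stable ex {u = node _ (node _ _)} h k l = k λ f → f l
  Op-stable mu {u = leaf} h k = k id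
  Op-stable mu {u = node _ _} h k l = k λ f → f l
  Op-stable path {u = leaf} h k = k id
  Op-stable path {u = node _ leaf} h k = k id
  Op-stable path {u = node _ (node _ _)} h k l = k λ f → f l

  Sat-stable : ∀ e {u} → ¬ ¬ Sat e u → Sat e u
  Sat-stable leaf k = k id
  Sat-stable (node leaf t) k = k id
  Sat-stable (node (node i j) t) k with decode (enc t)
  ... | just o  = Op-stable o (Sat-stable i) k
  ... | nothing = k id

-- The conditions on W

infixr 10 _∷ᵗ_

_∷ᵗ_ : ∀ {n} → Term n → Term n → Term n
s ∷ᵗ t = exp s ⊗ (t ⊕ t ⊕ 𝟏)

num : ∀ {n} → ℕ → Term n
num zero    = 𝟎
num (suc k) = 𝟏 ⊕ num k

opᵗ : ∀ {n} → Opcode → Term n → Term n → Term n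
opᵗ o i j = (i ∷ᵗ j) ∷ᵗ num (code o)

mem : ∀ {n} → Term n → Term n → Term n → Formula n 1
mem e s r = e ∷ᵗ (s ∷ᵗ r) ∈ zero

memSet : ∀ {n} → Term n → Term n → Formula n 1
memSet e x = mem e 𝟎 (x ∷ᵗ 𝟎)

all≺ some≺ : ∀ {n m} → Term n → Formula (suc n) m → Formula n m
all≺ t φ  = ∀¹ (v₀ ≺ wkT t ⇒ φ)
some≺ t φ = ∃¹ (v₀ ≺ wkT t ∧ φ)

digit : ∀ {n m} → Term n → Term n → Formula (2 + n) m
digit i c = wkT (wkT c) ≐ (v₁ ⊕ v₁ ⊕ 𝟏) ⊗ exp (wkT (wkT i)) ⊕ v₀

-- `Bit` has an unbounded quantifier, but the number a in it is at most c; with that bound the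
-- conditions are Δ⁰₀.
Bit≺ : ∀ {n m} → Term n → Term n → Formula n m
Bit≺ i c = some≺ (c ⊕ 𝟏) (some≺ (exp (wkT i)) (digit i c))

prefix : ∀ {n} → Term n → Term n → Formula (3 + n) 1
prefix e c = wkT (wkT (wkT c)) ≐ (𝟏 ⊕ v₁) ⊗ exp (var (# 2)) ⊕ v₀ ⇒
             memSet (wkT (wkT (wkT e))) (exp (var (# 2)) ⊕ v₀)

prefixes : ∀ {n} → Term n → Term n → Formula n 1
prefixes e c = all≺ (c ⊕ 𝟏) (all≺ (wkT c ⊕ 𝟏) (all≺ (exp v₁) (prefix e c)))

clause : ∀ {n} → (i j s r x y : Term n) → Opcode → Formula n 1
clause i j s r x y const = mem (opᵗ const i j) s r ⇔ mem i s (j ∷ᵗ r)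
clause i j s r x y dup   = mem (opᵗ dup i j) s (x ∷ᵗ r) ⇔ mem i s (x ∷ᵗ x ∷ᵗ r)
clause i j s r x y move  = mem (opᵗ move i j) s (x ∷ᵗ r) ⇔ mem i (x ∷ᵗ s) r
clause i j s r x y back  = mem (opᵗ back i j) (x ∷ᵗ s) (y ∷ᵗ r) ⇔ mem i s (y ∷ᵗ x ∷ᵗ r)
clause i j s r x y add   = mem (opᵗ add i j) (x ∷ᵗ s) (y ∷ᵗ r) ⇔ mem i s ((x ⊕ y) ∷ᵗ r)
clause i j s r x y mul   = mem (opᵗ mul i j) (x ∷ᵗ s) (y ∷ᵗ r) ⇔ mem i s ((x ⊗ y) ∷ᵗ r)
clause i j s r x y pow   = mem (opᵗ pow i j) s (x ∷ᵗ r) ⇔ mem i s (exp x ∷ᵗ r)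
clause i j s r x y bind  = mem (opᵗ bind i j) s (x ∷ᵗ r) ⇔ mem i 𝟎 (x ∷ᵗ j)
clause i j s r x y eq    = mem (opᵗ eq i j) (x ∷ᵗ s) (y ∷ᵗ r) ⇔ x ≐ y
clause i j s r x y nor   = mem (opᵗ nor i j) s r ⇔ ∼ mem i s r ∧ ∼ mem j s r
-- Bounded search by recursion on the bound, which stands on top of the stack: nothing is found
-- below 0, and what is found below x + 1 is found below x or is x.
clause i j s r x y ex    = ∼ mem (opᵗ ex i j) s (𝟎 ∷ᵗ r) ∧
  (mem (opᵗ ex i j) s ((𝟏 ⊕ x) ∷ᵗ r) ⇔ mem (opᵗ ex i j) s (x ∷ᵗ r) ∨ mem i s (x ∷ᵗ r))
-- The program `ex` with bound y says that a smaller number passes the test i; if none does, y is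
-- the result of the search. Since the clause starts from a y that passes, it is silent about
-- failing searches.
clause i j s r x y mu    = mem i s (y ∷ᵗ r) ⇒ mem (opᵗ ex i j) s (y ∷ᵗ r) ∨
  (mem (opᵗ mu i j) s r ⇔ mem j s (y ∷ᵗ r))
-- If 2^s + x codes a node of the tree, then the path has an initial segment of
-- length s in the tree; 2^s + r is its code, and j witnesses r < 2^s.
clause i j s r x y path  = exp s ≐ 𝟏 ⊕ r ⊕ j ⇒ prefixes i (exp s ⊕ x) ⇒
  all≺ s (Bit≺ v₀ (wkT r) ⇔ memSet (opᵗ path (wkT i) 𝟎) v₀) ⇒ memSet i (exp s ⊕ r)

⇔-Δ⁰₀ : ∀ {n m} {φ ψ : Formula n m} → Δ⁰₀ φ → Δ⁰₀ ψ → Δ⁰₀ (φ ⇔ ψ)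
⇔-Δ⁰₀ φ ψ = (φ ⇒ ψ) ∧ (ψ ⇒ φ)

Bit≺-Δ⁰₀ : ∀ {n m} (i c : Term n) → Δ⁰₀ (Bit≺ {m = m} i c)
Bit≺-Δ⁰₀ i c = ∃≺ (c ⊕ 𝟏) (∃≺ (exp (wkT i)) (_ ≐ _))

prefixes-Δ⁰₀ : ∀ {n} (e c : Term n) → Δ⁰₀ (prefixes e c)
prefixes-Δ⁰₀ e c = ∀≺ (c ⊕ 𝟏) (∀≺ (wkT c ⊕ 𝟏) (∀≺ (exp v₁) (_ ≐ _ ⇒ _ ∈ _)))

clause-Δ⁰₀ : ∀ {n} (i j s r x y : Term n) o → Δ⁰₀ (clause i j s r x y o)
clause-Δ⁰₀ i j s r x y const = ⇔-Δ⁰₀ (_ ∈ _) (_ ∈ _)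
clause-Δ⁰₀ i j s r x y dup   = ⇔-Δ⁰₀ (_ ∈ _) (_ ∈ _)
clause-Δ⁰₀ i j s r x y move  = ⇔-Δ⁰₀ (_ ∈ _) (_ ∈ _)
clause-Δ⁰₀ i j s r x y back  = ⇔-Δ⁰₀ (_ ∈ _) (_ ∈ _)
clause-Δ⁰₀ i j s r x y add   = ⇔-Δ⁰₀ (_ ∈ _) (_ ∈ _)
clause-Δ⁰₀ i j s r x y mul   = ⇔-Δ⁰₀ (_ ∈ _) (_ ∈ _)
clause-Δ⁰₀ i j s r x y pow   = ⇔-Δ⁰₀ (_ ∈ _) (_ ∈ _)
clause-Δ⁰₀ i j s r x y bind  = ⇔-Δ⁰₀ (_ ∈ _) (_ ∈ _)
clause-Δ⁰₀ i j s r x y eq    = ⇔-Δ⁰₀ (_ ∈ _) (_ ≐ _)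
clause-Δ⁰₀ i j s r x y nor   = ⇔-Δ⁰₀ (_ ∈ _) ((_ ∈ _ ⇒ ⊥) ∧ (_ ∈ _ ⇒ ⊥))
clause-Δ⁰₀ i j s r x y ex    = (_ ∈ _ ⇒ ⊥) ∧ ⇔-Δ⁰₀ (_ ∈ _) (_ ∈ _ ∨ _ ∈ _)
clause-Δ⁰₀ i j s r x y mu    = _ ∈ _ ⇒ _ ∈ _ ∨ ⇔-Δ⁰₀ (_ ∈ _) (_ ∈ _)
clause-Δ⁰₀ i j s r x y path  =
  _ ≐ _ ⇒ prefixes-Δ⁰₀ i (exp s ⊕ x) ⇒ ∀≺ s (⇔-Δ⁰₀ (Bit≺-Δ⁰₀ v₀ (wkT r)) (_ ∈ _)) ⇒ _ ∈ _

every : ∀ {n m} → (Opcode → Formula n m) → Formula n m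
every φ = φ const ∧ φ dup ∧ φ move ∧ φ back ∧ φ add ∧ φ mul ∧ φ pow ∧
          φ bind ∧ φ eq ∧ φ nor ∧ φ ex ∧ φ mu ∧ φ path

every-Δ⁰₀ : ∀ {n m} {φ : Opcode → Formula n m} → (∀ o → Δ⁰₀ (φ o)) → Δ⁰₀ (every φ)
every-Δ⁰₀ δ = δ const ∧ δ dup ∧ δ move ∧ δ back ∧ δ add ∧ δ mul ∧ δ pow ∧
              δ bind ∧ δ eq ∧ δ nor ∧ δ ex ∧ δ mu ∧ δ path

sat-every : ∀ {n m} (φ : Opcode → Formula n m) {ρ V} → sat (every φ) ρ V ↔ (∀ o → sat (φ o) ρ V)
sat-every φ = (λ { (a , b , c , d , e , f , g , h , i , j , k , l , m) →
                     λ { const → a ; dup → b ; move → c ; back → d ; add → e ; mul → f ; pow → g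
                       ; bind → h ; eq → i ; nor → j ; ex → k ; mu → l ; path → m } })
            , λ h → h const , h dup , h move , h back , h add , h mul , h pow ,
                    h bind , h eq , h nor , h ex , h mu , h path

v₂ v₃ v₄ v₅ : ∀ {n} → Term (6 + n)
v₂ = var (suc (suc zero))
v₃ = var (suc (suc (suc zero)))
v₄ = var (suc (suc (suc (suc zero))))
v₅ = var (suc (suc (suc (suc (suc zero)))))

clauses₆ : Formula 7 1
clauses₆ = every (clause v₅ v₄ v₃ v₂ v₁ v₀)

clauses₅ : Formula 6 1
clauses₅ = all≺ v₅ clauses₆

clauses₄ : Formula 5 1
clauses₄ = all≺ (var (# 4)) clauses₅

clauses₃ : Formula 4 1
clauses₃ = all≺ (var (# 3)) clauses₄

clauses₂ : Formula 3 1
clauses₂ = all≺ (var (# 2)) clauses₃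

clauses₁ : Formula 2 1
clauses₁ = all≺ v₁ clauses₂

-- Condition n gathers the clauses with all six parameters below n. A single index suffices, and
-- later conditions imply earlier ones.
clauses : Formula 1 1
clauses = all≺ v₀ clauses₁

clauses-Δ⁰₀ : Δ⁰₀ clauses
clauses-Δ⁰₀ = ∀≺ _ (∀≺ _ (∀≺ _ (∀≺ _ (∀≺ _ (∀≺ _ (every-Δ⁰₀ (clause-Δ⁰₀ v₅ v₄ v₃ v₂ v₁ v₀)))))))

env : (n i j s r x y : ℕ) → Vector ℕ 7
env n i j s r x y = y ▹ (x ▹ (r ▹ (s ▹ (j ▹ (i ▹ λ _ → n)))))

Clause : Real → (n i j s r x y : ℕ) → Opcode → Set
Clause V n i j s r x y o = sat (clause v₅ v₄ v₃ v₂ v₁ v₀ o) (env n i j s r x y) V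

sat-all≺ : ∀ {k} (t : Term k) (φ : Formula (suc k) 1) ρ V {P : ℕ → Set} →
           (∀ x → sat φ (x ▹ ρ) V ↔ P x) → sat (all≺ t φ) ρ V ↔ (∀ x → x < val t ρ → P x)
sat-all≺ t φ ρ V e = ↔-trans (Satisfaction.⟦∀≺⟧ (single V) t φ) (Π-cong λ x → →-cong ↔-refl (e x))

sat-some≺ : ∀ {k} (t : Term k) (φ : Formula (suc k) 1) ρ V {P : ℕ → Set} →
            (∀ x → sat φ (x ▹ ρ) V ↔ P x) → sat (some≺ t φ) ρ V ↔ ¬ ¬ (∃[ x ] x < val t ρ × P x)
sat-some≺ t φ ρ V e = ↔-trans (Satisfaction.⟦∃≺⟧ (single V) t φ) (¬¬∃-cong λ x → ×-cong ↔-refl (e x))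

sat-clauses : ∀ n V → sat clauses (λ _ → n) V ↔
  (∀ i → i < n → ∀ j → j < n → ∀ s → s < n → ∀ r → r < n → ∀ x → x < n → ∀ y → y < n →
   ∀ o → Clause V n i j s r x y o)
sat-clauses n V =
  sat-all≺ v₀ clauses₁ (λ _ → n) V λ i →
  sat-all≺ v₁ clauses₂ (i ▹ λ _ → n) V λ j →
  sat-all≺ (var (# 2)) clauses₃ (j ▹ (i ▹ λ _ → n)) V λ s →
  sat-all≺ (var (# 3)) clauses₄ (s ▹ (j ▹ (i ▹ λ _ → n))) V λ r →
  sat-all≺ (var (# 4)) clauses₅ (r ▹ (s ▹ (j ▹ (i ▹ λ _ → n)))) V λ x →
  sat-all≺ v₅ clauses₆ (x ▹ (r ▹ (s ▹ (j ▹ (i ▹ λ _ → n))))) V λ y →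
  sat-every (clause v₅ v₄ v₃ v₂ v₁ v₀)

PathClause : Real → (i s r x : ℕ) → Set
PathClause V i s r x = r < 2 ** s → Prefixes T (2 ** s + x) → (∀ b → b < s → bit b r ↔ P b) → T (2 ** s + r)
  where
  T P : ℕ → Set
  T n = at V (pr i (pr 0 (pr n 0)))
  P n = at V (pr (pr (pr i 0) (code path)) (pr 0 (pr n 0)))

module _ (V : Real) where
  open Satisfaction (single V)

  ⟦Bit≺⟧ : ∀ {n} (i c : Term n) ρ → sat (Bit≺ {m = 1} i c) ρ V ↔ bit (val i ρ) (val c ρ)
  ⟦Bit≺⟧ i c ρ = ↔-trans
    (sat-some≺ (c ⊕ 𝟏) (some≺ (exp (wkT i)) (digit i c)) ρ V λ a →
     sat-some≺ (exp (wkT i)) (digit i c) (a ▹ ρ) V λ q →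
       ≡⇒↔ (cong₂ (λ z w → w ≡ (a + a + 1) * 2 ** z + q) (val-wk₂ i) (val-wk₂ c)))
    (to , from)
    where
    Digits : Set
    Digits = ¬ ¬ (∃[ a ] a < val c ρ + 1 ×
      ¬ ¬ (∃[ q ] q < 2 ** val (wkT i) (a ▹ ρ) × val c ρ ≡ (a + a + 1) * 2 ** val i ρ + q))

    to : Digits → bit (val i ρ) (val c ρ)
    to k = bit-stable (val i ρ) λ h → k λ { (a , _ , l) → l λ { (q , q< , e) →
      h (digit⇒bit (val i ρ) a (subst (λ z → q < 2 ** z) (val-wk i) q<) e) } }

    from : bit (val i ρ) (val c ρ) → Digits
    from h k with bit⇒digit (val i ρ) h
    ... | a , q , q< , e = k (a , a< , λ l → l (q , subst (λ z → q < 2 ** z) (sym (val-wk i)) q< , e))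
      where
      open ≤-Reasoning
      a< : a < val c ρ + 1
      a< = begin-strict
        a                                ≤⟨ m≤m+n a a ⟩
        a + a                            <⟨ m<m+n (a + a) (s≤s z≤n) ⟩
        a + a + 1                        ≤⟨ m≤m*n (a + a + 1) (2 ** val i ρ) ⦃ m^n≢0 2 (val i ρ) ⦄ ⟩
        (a + a + 1) * 2 ** val i ρ       ≤⟨ m≤m+n _ q ⟩
        (a + a + 1) * 2 ** val i ρ + q   ≡⟨ sym e ⟩
        val c ρ                          ≤⟨ m≤m+n (val c ρ) 1 ⟩
        val c ρ + 1                      ∎

  -- The bounds lose nothing: c = (a + 1) · 2^ℓ + q implies ℓ < 2^ℓ ≤ c and a < c.
  ⟦prefixes⟧ : ∀ {n} (e c : Term n) ρ →
    sat (prefixes e c) ρ V ↔ Prefixes (λ q → at V (pr (val e ρ) (pr 0 (pr q 0)))) (val c ρ)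
  ⟦prefixes⟧ e c ρ = ↔-trans
    (sat-all≺ (c ⊕ 𝟏) (all≺ (wkT c ⊕ 𝟏) (all≺ (exp v₁) (prefix e c))) ρ V λ ℓ →
     sat-all≺ (wkT c ⊕ 𝟏) (all≺ (exp v₁) (prefix e c)) (ℓ ▹ ρ) V λ a →
     sat-all≺ (exp v₁) (prefix e c) (a ▹ (ℓ ▹ ρ)) V λ q → →-cong
       (≡⇒↔ (cong (_≡ suc a * 2 ** ℓ + q) (val-wk₃ c)))
       (≡⇒↔ (cong (λ z → at V (pr z (pr 0 (pr (2 ** ℓ + q) 0)))) (val-wk₃ e))))
    ((λ h ℓ a q q< e → h ℓ (ℓ< {a = a} e) a (subst (λ z → a < z + 1) (sym (val-wk c)) (a< {ℓ} e)) q q< e) ,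
     λ h ℓ _ a _ q → h ℓ a q)
    where
    open ≤-Reasoning
    val-wk₃ : ∀ (u : Term _) {x y z} → val (wkT (wkT (wkT u))) (x ▹ (y ▹ (z ▹ ρ))) ≡ val u ρ
    val-wk₃ u = trans (val-wk (wkT (wkT u))) (val-wk₂ u)
    ℓ< : ∀ {c ℓ a q} → c ≡ suc a * 2 ** ℓ + q → ℓ < c + 1
    ℓ< {c} {ℓ} {a} {q} e = begin-strict
      ℓ                  <⟨ n<2^n ℓ ⟩
      2 ** ℓ             ≤⟨ m≤m+n (2 ** ℓ) (a * 2 ** ℓ) ⟩
      suc a * 2 ** ℓ     ≤⟨ m≤m+n _ q ⟩
      suc a * 2 ** ℓ + q ≡⟨ sym e ⟩
      c                  ≤⟨ m≤m+n c 1 ⟩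
      c + 1              ∎
    a< : ∀ {ℓ c a q} → c ≡ suc a * 2 ** ℓ + q → a < c + 1
    a< {ℓ} {c} {a} {q} e = begin-strict
      a                  <⟨ n<1+n a ⟩
      suc a              ≤⟨ m≤m*n (suc a) (2 ** ℓ) ⦃ m^n≢0 2 ℓ ⦄ ⟩
      suc a * 2 ** ℓ     ≤⟨ m≤m+n _ q ⟩
      suc a * 2 ** ℓ + q ≡⟨ sym e ⟩
      c                  ≤⟨ m≤m+n c 1 ⟩
      c + 1              ∎

  ⟦digits⟧ : ∀ n i j s r x y →
             sat (all≺ v₃ (Bit≺ v₀ (wkT v₂) ⇔ memSet (opᵗ path (wkT v₅) 𝟎) v₀)) (env n i j s r x y) V ↔
             (∀ b → b < s → bit b r ↔ at V (pr (pr (pr i 0) (code path)) (pr 0 (pr b 0))))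
  ⟦digits⟧ n i j s r x y = ↔-trans
    (⟦∀≺⟧ v₃ (Bit≺ v₀ (wkT v₂) ⇔ memSet (opᵗ path (wkT v₅) 𝟎) v₀) {ρ = env n i j s r x y})
    (Π-cong λ b → →-cong ↔-refl (⇔-cong (⟦Bit≺⟧ v₀ (wkT v₂) (b ▹ env n i j s r x y)) ↔-refl))

  path-clause : ∀ n i j s r x y → PathClause V i s r x → Clause V n i j s r x y path
  path-clause n i j s r x y h e p b = h (≤-trans (m≤m+n (suc r) j) (≤-reflexive (sym e)))
    (proj₁ (⟦prefixes⟧ v₅ (exp v₃ ⊕ v₁) (env n i j s r x y)) p) (proj₁ (⟦digits⟧ n i j s r x y) b)

  clause-path : ∀ n i s r x y → Clause V n i (2 ** s ∸ suc r) s r x y path → PathClause V i s r x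
  clause-path n i s r x y h r< p b = h (sym (m+[n∸m]≡n r<))
    (proj₂ (⟦prefixes⟧ v₅ (exp v₃ ⊕ v₁) (env n i j s r x y)) p) (proj₂ (⟦digits⟧ n i j s r x y) b)
    where j = 2 ** s ∸ suc r

-- Finite satisfiability of the conditions

greatest : ∀ (P : ℕ → Set) B {c} → c < B → P c → ¬ ¬ (∃[ m ] m < B × P m × (∀ d → d < B → P d → d ≤ m))
greatest P (suc B) {c} c< p k = ¬¬-excluded-middle λ
  { (yes q) → k (B , ≤-refl , q , λ d d< _ → m<1+n⇒m≤n d<)
  ; (no ¬q) → case m<1+n⇒m<n∨m≡n c< of λ
      { (inj₂ refl) → ¬q p
      ; (inj₁ h) → greatest P B h p λ { (m , m< , pm , max) → k (m , m<n⇒m<1+n m< , pm , λ d d< pd →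
          case m<1+n⇒m<n∨m≡n d< of λ { (inj₁ h) → max d h pd ; (inj₂ refl) → contradiction pd ¬q }) } } }

-- The bound exceeds every 2^s + x with s, x < N.
module _ (N : ℕ) where

  B : ℕ
  B = 2 ** N + N

  Holds : Tree → Set
  Holds leaf       = Empty
  Holds (node e u) = Sat B e u

  Holds-stable : ∀ t → ¬ ¬ Holds t → Holds t
  Holds-stable leaf       k = k id
  Holds-stable (node e u) k = Sat-stable B e k

  solution : Real
  solution = real (λ n → Holds (dec n)) λ {n} → Holds-stable (dec n)

  at-arg : ∀ e u → at solution (pr (enc e) (enc u)) ↔ Sat B e u
  at-arg e u = ≡⇒↔ (cong Holds (dec-enc (node e u)))

  at-op : ∀ o i j u → at solution (pr (pr (pr (enc i) (enc j)) (code o)) (enc u)) ↔ Op B o (Sat B i) (Sat B j) j u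
  at-op o i j u = ↔-trans
    (≡⇒↔ (cong (λ k → at solution (pr (pr (pr (enc i) (enc j)) k) (enc u))) (sym (enc-dec (code o)))))
    (↔-trans (at-arg (node (node i j) (dec (code o))) u)
      (≡⇒↔ (cong (maybe′ (λ o → Op B o (Sat B i) (Sat B j) j u) Empty)
        (trans (cong decode (enc-dec (code o))) (decode-code o)))))

  at-top : ∀ e s n r → at solution (pr (enc e) (pr (enc s) (pr n (enc r)))) ↔ Sat B e (node s (node (dec n) r))
  at-top e s n r = ↔-trans
    (≡⇒↔ (cong (λ m → at solution (pr (enc e) (pr (enc s) (pr m (enc r))))) (sym (enc-dec n))))
    (at-arg e (node s (node (dec n) r)))

  -- The number 2^s + x is below `B` and has its prefixes in the tree. Hence the greatest such m is
  -- at least 2^s and so has a prefix of length s, which lies in the tree. The digits of m are those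
  -- that `path` outputs, so this prefix is 2^s + r.
  solution-path : ∀ i s r x → s < N → x < N → PathClause solution (enc i) s r x
  solution-path i s r x s< x< r< p b = at-stable solution {pr (enc i) (pr 0 (pr (2 ** s + r) 0))} λ k →
    greatest (Prefixes (number (Sat B i))) B c< c-prefixes λ { (m , m< , pm , max) →
        k (proj₂ (at-top i leaf (2 ** s + r) leaf)
          (subst (λ z → number (Sat B i) (2 ** s + z)) (tail≡ m< pm max)
            (pm s (proj₁ (high m max)) (tail m) (m%n<n m (2 ** s) ⦃ m^n≢0 2 s ⦄) (proj₂ (high m max))))) }
    where
    instance _ = m^n≢0 2 s
    tail : ℕ → ℕ
    tail m = m % 2 ** s

    c< : 2 ** s + x < B
    c< = +-mono-< (^-monoʳ-< 2 (s≤s (s≤s z≤n)) s<) x<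

    Max : ℕ → Set
    Max m = ∀ d → d < B → Prefixes (number (Sat B i)) d → d ≤ m

    c-prefixes : Prefixes (number (Sat B i)) (2 ** s + x)
    c-prefixes ℓ a q q< e = proj₁ (at-top i leaf (2 ** ℓ + q) leaf) (p ℓ a q q< e)

    high : ∀ m → Max m → ∃[ a ] m ≡ suc a * 2 ** s + tail m
    high m max with m / 2 ** s in e
    ... | zero  = contradiction (≤-trans (m≤m+n (2 ** s) x) (max _ c< c-prefixes)) (<⇒≱ (m/n≡0⇒m<n e))
    ... | suc a = a , trans (m≡m%n+[m/n]*n m (2 ** s))
                     (trans (+-comm (tail m) _) (cong (λ z → z * 2 ** s + tail m) e))

    tail≡ : ∀ {m} → m < B → Prefixes (number (Sat B i)) m → Max m → tail m ≡ r
    tail≡ {m} m< pm max = bit-injective s (m%n<n m (2 ** s)) r< λ z z< → ↔-trans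
      (↔-sym (subst (λ w → bit z w ↔ bit z (tail m)) (sym (proj₂ (high m max)))
        (bit-mod z< (suc (proj₁ (high m max))) (tail m))))
      (↔-trans
        ( (λ h → proj₂ (at-op path i leaf (node leaf (node (dec z) leaf)))
            λ k → k (m , (m< , pm , max) , subst (λ w → bit w m) (sym (enc-dec z)) h))
        , λ h → bit-stable z λ k → proj₁ (at-op path i leaf (node leaf (node (dec z) leaf))) h
            λ { (m′ , (m′< , pm′ , max′) , h′) →
              k (subst₂ bit (enc-dec z) (≤-antisym (max m′ m′< pm′) (max′ m m< pm)) h′) })
      (↔-trans (≡⇒↔ (cong (λ w → at solution (pr (pr (pr (enc i) 0) (code path)) (pr 0 (pr w 0)))) (enc-dec z)))
        (↔-sym (b z z<))))

  solution-clause : ∀ n i j s r x y → enc s < N → enc x < N → ∀ o →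
                    Clause solution n (enc i) (enc j) (enc s) (enc r) (enc x) (enc y) o
  solution-clause n i j s r x y s< x< const =
    ↔-trans (at-op const i j (node s r)) (↔-sym (at-arg i (node s (node j r))))
  solution-clause n i j s r x y s< x< dup =
    ↔-trans (at-op dup i j (node s (node x r))) (↔-sym (at-arg i (node s (node x (node x r)))))
  solution-clause n i j s r x y s< x< move =
    ↔-trans (at-op move i j (node s (node x r))) (↔-sym (at-arg i (node (node x s) r)))
  solution-clause n i j s r x y s< x< back =
    ↔-trans (at-op back i j (node (node x s) (node y r))) (↔-sym (at-arg i (node s (node y (node x r)))))
  solution-clause n i j s r x y s< x< add =
    ↔-trans (at-op add i j (node (node x s) (node y r))) (↔-sym (at-top i s (enc x + enc y) r))
  solution-clause n i j s r x y s< x< mul =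
    ↔-trans (at-op mul i j (node (node x s) (node y r))) (↔-sym (at-top i s (enc x * enc y) r))
  solution-clause n i j s r x y s< x< pow =
    ↔-trans (at-op pow i j (node s (node x r))) (↔-sym (at-top i s (2 ** enc x) r))
  solution-clause n i j s r x y s< x< bind =
    ↔-trans (at-op bind i j (node s (node x r))) (↔-sym (at-arg i (node leaf (node x j))))
  solution-clause n i j s r x y s< x< eq = at-op eq i j (node (node x s) (node y r))
  solution-clause n i j s r x y s< x< nor =
    ↔-trans (at-op nor i j (node s r))
      (↔-sym (×-cong (¬-cong (at-arg i (node s r))) (¬-cong (at-arg j (node s r)))))
  solution-clause n i j s r x y s< x< ex = none , ↔-trans (at-ex (suc (enc x))) (↔-trans (bounded , bounded⁻¹)
    (↔-sym (¬¬⊎-cong (at-ex (enc x)) (at-arg i (node s (node x r))))))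
    where
    Below : ℕ → Set
    Below m = ¬ ¬ (∃[ y ] y < m × Sat B i (node s (node (dec y) r)))

    at-ex : ∀ m → at solution (pr (pr (pr (enc i) (enc j)) (code ex)) (pr (enc s) (pr m (enc r)))) ↔ Below m
    at-ex m = subst
      (λ z → at solution (pr (pr (pr (enc i) (enc j)) (code ex)) (pr (enc s) (pr z (enc r)))) ↔ Below z)
      (enc-dec m) (at-op ex i j (node s (node (dec m) r)))

    none : ¬ at solution (pr (pr (pr (enc i) (enc j)) (code ex)) (pr (enc s) (pr 0 (enc r))))
    none h = proj₁ (at-ex 0) h λ ()

    bounded : Below (suc (enc x)) → ¬ ¬ (Below (enc x) ⊎ Sat B i (node s (node x r)))
    bounded h k = h λ { (y , y< , a) → case m<1+n⇒m<n∨m≡n y< of λ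
      { (inj₁ y<x) → k (inj₁ λ l → l (y , y<x , a))
      ; (inj₂ refl) → k (inj₂ (subst (λ t → Sat B i (node s (node t r))) (dec-enc x) a)) } }

    bounded⁻¹ : ¬ ¬ (Below (enc x) ⊎ Sat B i (node s (node x r))) → Below (suc (enc x))
    bounded⁻¹ h k = h λ
      { (inj₁ l) → l λ { (y , y< , a) → k (y , m<n⇒m<1+n y< , a) }
      ; (inj₂ a) → k (enc x , ≤-refl , subst (λ t → Sat B i (node s (node t r))) (sym (dec-enc x)) a) }
  solution-clause n i j s r x y s< x< mu a k = ¬¬-excluded-middle λ
    { (yes e) → k (inj₁ (proj₂ (at-op ex i j (node s (node y r))) e))
    ; (no ¬e) → k (inj₂ (↔-trans (at-op mu i j (node s r))
        (↔-trans (minimal ¬e) (↔-sym (at-arg j (node s (node y r))))))) }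
    where
    a′ : Sat B i (node s (node (dec (enc y)) r))
    a′ = proj₁ (at-top i s (enc y) r) a

    module _ (¬e : ¬ Op B ex (Sat B i) (Sat B j) j (node s (node y r))) where
      least : ∀ z → z < enc y → ¬ Sat B i (node s (node (dec z) r))
      least z z< b = ¬e λ l → l (z , z< , b)

      minimal : Op B mu (Sat B i) (Sat B j) j (node s r) ↔ Sat B j (node s (node y r))
      minimal = (λ h → Sat-stable B j λ k → h λ { (z , b , l , d) → case <-cmp z (enc y) of λ
                  { (tri< z< _ _) → least z z< b
                  ; (tri≈ _ refl _) → k (subst (λ t → Sat B j (node s (node t r))) (dec-enc y) d)
                  ; (tri> _ _ y<) → l (enc y) y< a′ } })
              , λ d k → k (enc y , a′ , least , subst (λ t → Sat B j (node s (node t r))) (sym (dec-enc y)) d)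
  solution-clause n i j s r x y s< x< path =
    path-clause solution n (enc i) (enc j) (enc s) (enc r) (enc x) (enc y)
      (solution-path i (enc s) (enc r) (enc x) s< x<)

solution-solves : ∀ N n → n < N → sat clauses (λ _ → n) (solution N)
solution-solves N n n< = proj₂ (sat-clauses n (solution N)) λ i _ j _ s s< r _ x x< y _ →
  onTrees {λ i → Clause′ i j s r x y} (λ I →
  onTrees {λ j → Clause′ (enc I) j s r x y} (λ J →
  onTrees {λ s → s < n → Clause′ (enc I) (enc J) s r x y} (λ S s< →
  onTrees {λ r → Clause′ (enc I) (enc J) (enc S) r x y} (λ R →
  onTrees {λ x → x < n → Clause′ (enc I) (enc J) (enc S) (enc R) x y} (λ X x< →
  onTrees {λ y → Clause′ (enc I) (enc J) (enc S) (enc R) (enc X) y} (λ Y →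
    solution-clause N n I J S R X Y (<-trans s< n<) (<-trans x< n<)) y) x x<) r) s s<) j) i
  where
  Clause′ : (i j s r x y : ℕ) → Set
  Clause′ i j s r x y = ∀ o → Clause (solution N) n i j s r x y o

-- The ω-model of the sections of W

module Model (W : Real) (closed : ∀ n → sat clauses (λ _ → n) W) where

  rule : ∀ i j s r x y o → ∃[ n ] Clause W n i j s r x y o
  rule i j s r x y o = n , proj₁ (sat-clauses n W) (closed n)
    i (s≤s (≤-trans (m≤m+n i j) (≤-trans (m≤m+n (i + j) s) (≤-trans (m≤m+n _ r) (≤-trans (m≤m+n _ x) (m≤m+n _ y))))))
    j (s≤s (≤-trans (m≤n+m j i) (≤-trans (m≤m+n (i + j) s) (≤-trans (m≤m+n _ r) (≤-trans (m≤m+n _ x) (m≤m+n _ y))))))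
    s (s≤s (≤-trans (m≤n+m s (i + j)) (≤-trans (m≤m+n _ r) (≤-trans (m≤m+n _ x) (m≤m+n _ y)))))
    r (s≤s (≤-trans (m≤n+m r (i + j + s)) (≤-trans (m≤m+n _ x) (m≤m+n _ y))))
    x (s≤s (≤-trans (m≤n+m x (i + j + s + r)) (m≤m+n _ y)))
    y (s≤s (m≤n+m y (i + j + s + r + x))) o
    where
    n : ℕ
    n = suc (i + j + s + r + x + y)

  infix 4 _∋⟨_∣_⟩

  abstract
    -- The numbers s and r code stacks; computations take place on top of the
    -- stack r, and s stores intermediate results.
    _∋⟨_∣_⟩ : ℕ → ℕ → ℕ → Set
    e ∋⟨ s ∣ r ⟩ = at W (pr e (pr s r))

    cons : ℕ → ℕ → ℕ
    cons = pr

    op : Opcode → ℕ → ℕ → ℕ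
    op o i j = pr (pr i j) (code o)

    ∋-stable : ∀ {e s r} → ¬ ¬ (e ∋⟨ s ∣ r ⟩) → e ∋⟨ s ∣ r ⟩
    ∋-stable = at-stable W

    const-rule : ∀ i j s r → op const i j ∋⟨ s ∣ r ⟩ ↔ i ∋⟨ s ∣ cons j r ⟩
    const-rule i j s r = proj₂ (rule i j s r 0 0 const)

    dup-rule : ∀ i j s x r → op dup i j ∋⟨ s ∣ cons x r ⟩ ↔ i ∋⟨ s ∣ cons x (cons x r) ⟩
    dup-rule i j s x r = proj₂ (rule i j s r x 0 dup)

    move-rule : ∀ i j s x r → op move i j ∋⟨ s ∣ cons x r ⟩ ↔ i ∋⟨ cons x s ∣ r ⟩
    move-rule i j s x r = proj₂ (rule i j s r x 0 move)

    back-rule : ∀ i j x s y r → op back i j ∋⟨ cons x s ∣ cons y r ⟩ ↔ i ∋⟨ s ∣ cons y (cons x r) ⟩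
    back-rule i j x s y r = proj₂ (rule i j s r x y back)

    add-rule : ∀ i j x s y r → op add i j ∋⟨ cons x s ∣ cons y r ⟩ ↔ i ∋⟨ s ∣ cons (x + y) r ⟩
    add-rule i j x s y r = proj₂ (rule i j s r x y add)

    mul-rule : ∀ i j x s y r → op mul i j ∋⟨ cons x s ∣ cons y r ⟩ ↔ i ∋⟨ s ∣ cons (x * y) r ⟩
    mul-rule i j x s y r = proj₂ (rule i j s r x y mul)

    pow-rule : ∀ i j s x r → op pow i j ∋⟨ s ∣ cons x r ⟩ ↔ i ∋⟨ s ∣ cons (2 ** x) r ⟩
    pow-rule i j s x r = proj₂ (rule i j s r x 0 pow)

    -- Both stacks are reset. With j = 0 this asks whether x is in the set with index i, as needed
    -- for set parameters; with j a stack of numbers it fixes number parameters, as in the s-m-n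
    -- theorem.
    bind-rule : ∀ i j s x r → op bind i j ∋⟨ s ∣ cons x r ⟩ ↔ i ∋⟨ 0 ∣ cons x j ⟩
    bind-rule i j s x r = proj₂ (rule i j s r x 0 bind)

    eq-rule : ∀ i j x s y r → op eq i j ∋⟨ cons x s ∣ cons y r ⟩ ↔ x ≡ y
    eq-rule i j x s y r = proj₂ (rule i j s r x y eq)

    nor-rule : ∀ i j s r → op nor i j ∋⟨ s ∣ r ⟩ ↔ ¬ i ∋⟨ s ∣ r ⟩ × ¬ j ∋⟨ s ∣ r ⟩
    nor-rule i j s r = proj₂ (rule i j s r 0 0 nor)

    ex-rule : ∀ i j s n r → op ex i j ∋⟨ s ∣ cons n r ⟩ ↔ ¬ ¬ (∃[ y ] y < n × i ∋⟨ s ∣ cons y r ⟩)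
    ex-rule i j s zero r =
      (λ h → contradiction h (proj₁ (proj₂ (rule i j s r 0 0 ex)))) ,
      λ k → ∋-stable {op ex i j} {s} {cons 0 r} λ _ → k λ ()
    ex-rule i j s (suc n) r = ↔-trans (proj₂ (proj₂ (rule i j s r n 0 ex)))
      ( (λ k h → k λ
          { (inj₁ b) → proj₁ (ex-rule i j s n r) b λ { (y , y< , a) → h (y , m<n⇒m<1+n y< , a) }
          ; (inj₂ a) → h (n , ≤-refl , a) })
      , λ k h → k λ { (y , y< , a) → case m<1+n⇒m<n∨m≡n y< of λ
          { (inj₁ y<n) → h (inj₁ (proj₂ (ex-rule i j s n r) λ l → l (y , y<n , a)))
          ; (inj₂ refl) → h (inj₂ a) } })

    -- Induction on y: the clause for y either yields a smaller number that passes the test, to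
    -- which the induction hypothesis applies, or gives the equivalence at y itself.
    mu-rule : ∀ i j s r y → i ∋⟨ s ∣ cons y r ⟩ →
      ¬ ¬ (∃[ z ] i ∋⟨ s ∣ cons z r ⟩ × (op mu i j ∋⟨ s ∣ r ⟩ ↔ j ∋⟨ s ∣ cons z r ⟩))
    mu-rule i j s r = <-rec _ λ y rec a k → proj₂ (rule i j s r 0 y mu) a λ
      { (inj₁ e) → proj₁ (ex-rule i j s y r) e λ { (z , z< , b) → rec z< b k }
      ; (inj₂ d) → k (y , a , d) }

    path-rule : ∀ i s r x → r < 2 ** s → Prefixes (λ q → i ∋⟨ 0 ∣ cons q 0 ⟩) (2 ** s + x) →
                (∀ b → b < s → bit b r ↔ op path i 0 ∋⟨ 0 ∣ cons b 0 ⟩) → i ∋⟨ 0 ∣ cons (2 ** s + r) 0 ⟩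
    path-rule i s r x = 
      clause-path W (proj₁ (rule i (2 ** s ∸ suc r) s r x 0 path)) i s r x 0
        (proj₂ (rule i (2 ** s ∸ suc r) s r x 0 path))

    ∋⇔W : ∀ e x → e ∋⟨ 0 ∣ cons x 0 ⟩ ↔ at W (pr e (pr 0 (pr x 0)))
    ∋⇔W e x = ↔-refl

  -- Every number is a program and hence an index, so the same number can be a set of the model and
  -- the value of e in θ.
  𝔐 : ωStructure
  𝔐 = record { Index = ℕ ; _∋_ = λ e x → e ∋⟨ 0 ∣ cons x 0 ⟩ ; stable = ∋-stable ; index = 0 }

  open Satisfaction 𝔐

  -- Compiling formulas into programs

  ⌜_⌝ : ∀ {n} → Vector ℕ n → ℕ
  ⌜_⌝ {zero}  ρ = 0
  ⌜_⌝ {suc n} ρ = cons (ρ zero) ⌜ ρ ∘ suc ⌝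

  -- The d entries above the wanted one are moved to s, the entry is copied, and each `back` slips
  -- one of them beneath the copy.
  pushVar : ∀ {n} → Fin n → ℕ → ℕ
  pushVar zero    a = op dup a 0
  pushVar (suc d) a = op move (pushVar d (op back a 0)) 0

  pushVar-rule : ∀ {n} (d : Fin n) a s ρ → pushVar d a ∋⟨ s ∣ ⌜ ρ ⌝ ⟩ ↔ a ∋⟨ s ∣ cons (ρ d) ⌜ ρ ⌝ ⟩
  pushVar-rule zero    a s ρ = dup-rule a 0 s _ _
  pushVar-rule (suc d) a s ρ = ↔-trans (move-rule _ 0 s _ _)
    (↔-trans (pushVar-rule d _ _ (ρ ∘ suc)) (back-rule a 0 _ s _ _))

  -- In continuation-passing style, a being the program that receives the value. The value of a
  -- first argument waits in s, so that r is again the environment when the second one is compiled.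
  push : ∀ {n} → Term n → ℕ → ℕ
  push (var d) a = pushVar d a
  push 𝟎       a = op const a 0
  push 𝟏       a = op const a 1
  push (t ⊕ u) a = push t (op move (push u (op add a 0)) 0)
  push (t ⊗ u) a = push t (op move (push u (op mul a 0)) 0)
  push (exp t) a = push t (op pow a 0)

  push-rule : ∀ {n} (t : Term n) a s ρ → push t a ∋⟨ s ∣ ⌜ ρ ⌝ ⟩ ↔ a ∋⟨ s ∣ cons (val t ρ) ⌜ ρ ⌝ ⟩
  push-rule (var d) a s ρ = pushVar-rule d a s ρ
  push-rule 𝟎       a s ρ = const-rule a 0 s _
  push-rule 𝟏       a s ρ = const-rule a 1 s _
  push-rule (t ⊕ u) a s ρ = ↔-trans (push-rule t _ s ρ) (↔-trans (move-rule _ 0 s _ _)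
    (↔-trans (push-rule u _ _ ρ) (add-rule a 0 _ s _ _)))
  push-rule (t ⊗ u) a s ρ = ↔-trans (push-rule t _ s ρ) (↔-trans (move-rule _ 0 s _ _)
    (↔-trans (push-rule u _ _ ρ) (mul-rule a 0 _ s _ _)))
  push-rule (exp t) a s ρ = ↔-trans (push-rule t _ s ρ) (pow-rule a 0 s _ _)

  -- Uniform in s, since the program may run inside a computation that has stored values there.
  Defines : ∀ {n} → ℕ → (Vector ℕ n → Set) → Set
  Defines e P = ∀ s ρ → e ∋⟨ s ∣ ⌜ ρ ⌝ ⟩ ↔ P ρ

  not : ℕ → ℕ
  not e = op nor e e

  not-rule : ∀ e s r → not e ∋⟨ s ∣ r ⟩ ↔ ¬ e ∋⟨ s ∣ r ⟩
  not-rule e s r = ↔-trans (nor-rule e e s r) (proj₁ , λ h → h , h)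

  Δ⁰₀-definable : ∀ {n m} {φ : Formula n m} → Δ⁰₀ φ → ∀ η → ∃[ e ] Defines e (λ ρ → ⟦ φ ⟧ ρ η)
  Δ⁰₀-definable (t ≐ u) η = push t (op move (push u (op eq 0 0)) 0) , λ s ρ →
    ↔-trans (push-rule t _ s ρ) (↔-trans (move-rule _ 0 s _ _)
      (↔-trans (push-rule u _ _ ρ) (eq-rule 0 0 _ s _ _)))
  Δ⁰₀-definable (t ∈ X) η = push t (op bind (η X) 0) , λ s ρ →
    ↔-trans (push-rule t _ s ρ) (bind-rule (η X) 0 s _ _)
  -- No clause evaluates program 0, so falsity is the `nor` of it and its negation, whatever `W`
  -- makes of it.
  Δ⁰₀-definable ⊥ η = op nor 0 (not 0) , λ s ρ →
    ↔-trans (nor-rule 0 (not 0) s _) ((λ { (a , b) → b (proj₂ (not-rule 0 s _) a) }) , λ ())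
  Δ⁰₀-definable (φ ∧ ψ) η with Δ⁰₀-definable φ η | Δ⁰₀-definable ψ η
  ... | e , p | f , q = op nor (not e) (not f) , λ s ρ → ↔-trans (nor-rule (not e) (not f) s _)
    (↔-trans (×-cong (not-not e s) (not-not f s)) (×-cong (p s ρ) (q s ρ)))
    where
    not-not : ∀ e s {r} → ¬ not e ∋⟨ s ∣ r ⟩ ↔ e ∋⟨ s ∣ r ⟩
    not-not e s = (λ h → ∋-stable λ k → h (proj₂ (not-rule e s _) k)) , λ a k → proj₁ (not-rule e s _) k a
  Δ⁰₀-definable (φ ∨ ψ) η with Δ⁰₀-definable φ η | Δ⁰₀-definable ψ η
  ... | e , p | f , q = not (op nor e f) , λ s ρ → ↔-trans (not-rule (op nor e f) s _)
    (↔-trans (¬-cong (↔-trans (nor-rule e f s _) (×-cong (¬-cong (p s ρ)) (¬-cong (q s ρ)))))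
      ((λ h k → h (k ∘ inj₁ , k ∘ inj₂)) , λ h (a , b) → h λ { (inj₁ x) → a x ; (inj₂ y) → b y }))
  Δ⁰₀-definable (_⇒_ {ψ = ψ′} φ ψ) η with Δ⁰₀-definable φ η | Δ⁰₀-definable ψ η
  ... | e , p | f , q = not (op nor (not e) f) , λ s ρ → ↔-trans (not-rule (op nor (not e) f) s _)
    (↔-trans (¬-cong (↔-trans (nor-rule (not e) f s _)
        (×-cong (¬-cong (↔-trans (not-rule e s _) (¬-cong (p s ρ)))) (¬-cong (q s ρ)))))
      ((λ h a → ⟦⟧-stable ψ′ λ b → h ((λ k → k a) , b)) , λ h (a , b) → a (b ∘ h)))
  Δ⁰₀-definable (∀≺ t {φ} δ) η with Δ⁰₀-definable δ η
  ... | e , p = not (push t (op ex (not e) 0)) , λ s ρ → ↔-trans (not-rule _ s _) (↔-trans (¬-cong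
      (↔-trans (push-rule t _ s ρ) (ex-rule (not e) 0 s _ _)))
    (↔-trans
      ( (λ h y y< → proj₁ (p s (y ▹ ρ)) (∋-stable λ k → h λ l → l (y , y< , proj₂ (not-rule e s _) k)))
      , λ h l → l λ { (y , y< , k) → proj₁ (not-rule e s _) k (proj₂ (p s (y ▹ ρ)) (h y y<)) })
      (↔-sym (⟦∀≺⟧ t φ))))
  Δ⁰₀-definable (∃≺ t {φ} δ) η with Δ⁰₀-definable δ η
  ... | e , p = push t (op ex e 0) , λ s ρ → ↔-trans (push-rule t _ s ρ) (↔-trans (ex-rule e 0 s _ _)
    (↔-trans (¬¬∃-cong λ y → ×-cong ↔-refl (p s (y ▹ ρ))) (↔-sym (⟦∃≺⟧ t φ))))

  -- e defines a set of pairs (b , ρ), increasing in b, whose union over b is P.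
  Enumerates : ∀ {n} → ℕ → (Vector ℕ n → Set) → Set
  Enumerates e P = ∀ s ρ →
    (∀ {b c} → b ≤ c → e ∋⟨ s ∣ cons b ⌜ ρ ⌝ ⟩ → e ∋⟨ s ∣ cons c ⌜ ρ ⌝ ⟩) ×
    (P ρ ↔ ¬ ¬ (∃[ b ] e ∋⟨ s ∣ cons b ⌜ ρ ⌝ ⟩))

  enumerate-definable : ∀ {n e} {P : Vector ℕ n → Set} → (∀ ρ → ¬ ¬ P ρ → P ρ) →
                        Defines e P → ∃[ f ] Enumerates f P
  enumerate-definable {e = e} P-stable d = op move e 0 , λ s ρ →
    let at-b b = ↔-trans (move-rule e 0 s b _) (d (cons b s) ρ) in
    (λ {b} {c} _ h → proj₂ (at-b c) (proj₁ (at-b b) h)) ,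
    (λ h k → k (0 , proj₂ (at-b 0) h)) , λ h → P-stable ρ (¬¬-map (λ { (b , a) → proj₁ (at-b b) a }) h)

  -- The stage b bounds the witness y and is also the stage at which y is tested; by monotonicity
  -- one number can do both, so a whole block of quantifiers needs a single stage. In the program,
  -- `dup` keeps b past the search, and `move` and `back` put y beneath it.
  enumerate-∃ : ∀ {n e} {P : Vector ℕ (suc n) → Set} → Enumerates e P →
                ∃[ f ] Enumerates f (λ ρ → ¬ ¬ (∃[ y ] P (y ▹ ρ)))
  enumerate-∃ {e = e} {P} d = op dup (op ex (op move (op back e 0) 0) 0) 0 , λ s ρ →
    let at-b : ∀ b → op dup (op ex (op move (op back e 0) 0) 0) 0 ∋⟨ s ∣ cons b ⌜ ρ ⌝ ⟩ ↔
                     ¬ ¬ (∃[ y ] y < b × e ∋⟨ s ∣ cons b (cons y ⌜ ρ ⌝) ⟩)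
        at-b b = ↔-trans (dup-rule _ 0 s b _) (↔-trans (ex-rule _ 0 s b _) (¬¬∃-cong λ y →
                   ×-cong ↔-refl (↔-trans (move-rule _ 0 s y _) (back-rule e 0 y s b _))))
    in (λ {b} {c} b≤c h → proj₂ (at-b c) (¬¬-map
          (λ { (y , y< , a) → y , <-≤-trans y< b≤c , proj₁ (d s (y ▹ ρ)) b≤c a }) (proj₁ (at-b b) h))) ,
       (λ h k → h λ { (y , p) → proj₁ (proj₂ (d s (y ▹ ρ))) p λ { (b , a) →
          -- The stage must be strictly above y and not below b.
          k (suc y ⊔ b , proj₂ (at-b _) λ l →
            l (y , m≤m⊔n (suc y) b , proj₁ (d s (y ▹ ρ)) (m≤n⊔m (suc y) b) a)) } }) ,
       λ h k → h λ { (b , a) → proj₁ (at-b b) a λ { (y , _ , c) →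
          k (y , proj₂ (proj₂ (d s (y ▹ ρ))) λ l → l (b , c)) } }

  Σ⁰₁-enumerable : ∀ {n m} {φ : Formula n m} → Σ⁰₁ φ → ∀ η → ∃[ e ] Enumerates e (λ ρ → ⟦ φ ⟧ ρ η)
  Σ⁰₁-enumerable (matrix {φ} δ) η = enumerate-definable (λ ρ → ⟦⟧-stable φ) (proj₂ (Δ⁰₀-definable δ η))
  Σ⁰₁-enumerable (∃¹ σ)         η = enumerate-∃ (proj₂ (Σ⁰₁-enumerable σ η))

  Π⁰₁-co-enumerable : ∀ {n m} {φ : Formula n m} → Π⁰₁ φ → ∀ η → ∃[ e ] Enumerates e (λ ρ → ¬ ⟦ φ ⟧ ρ η)
  Π⁰₁-co-enumerable (matrix δ) η with Δ⁰₀-definable δ η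
  ... | e , d = enumerate-definable {e = not e} (λ ρ k a → k λ b → b a) λ s ρ →
    ↔-trans (not-rule e s _) (¬-cong (d s ρ))
  Π⁰₁-co-enumerable (∀¹ {φ} π) η with enumerate-∃ (proj₂ (Π⁰₁-co-enumerable π η))
  ... | f , d = f , λ s ρ → proj₁ (d s ρ) , ↔-trans
    ( (λ h k → h λ x → ⟦⟧-stable φ λ a → k (x , a)) , λ h a → h λ { (x , b) → b (a x) })
    (proj₂ (d s ρ))

  -- Post's theorem: `mu` searches for a stage at which φ or the negation of ψ has been enumerated.
  -- One of them is at some stage, and at such a stage the enumeration of φ decides φ, because both
  -- cannot be.
  comprehension : ∀ {n m} {φ ψ : Formula (suc n) m} → Σ⁰₁ φ → Π⁰₁ ψ → ⊨ Comprehension φ ψ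
  comprehension {φ = φ} {ψ} σ π = ⊨closure (∀¹ (φ ⇔ ψ) ⇒ ∃² (∀¹ (v₀ ∈ zero ⇔ wk² φ))) λ ρ η e k →
    let a , p = Σ⁰₁-enumerable σ η
        b , q = Π⁰₁-co-enumerable π η
        i = not (op nor a b)
        i-rule : ∀ y x → i ∋⟨ 0 ∣ cons y ⌜ x ▹ ρ ⌝ ⟩ ↔
                 ¬ (¬ a ∋⟨ 0 ∣ cons y ⌜ x ▹ ρ ⌝ ⟩ × ¬ b ∋⟨ 0 ∣ cons y ⌜ x ▹ ρ ⌝ ⟩)
        i-rule y x = ↔-trans (not-rule (op nor a b) 0 _) (¬-cong (nor-rule a b 0 _))

        φ∨¬ψ : ∀ x → ¬ ¬ (∃[ y ] i ∋⟨ 0 ∣ cons y ⌜ x ▹ ρ ⌝ ⟩)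
        φ∨¬ψ x k = ¬¬-excluded-middle λ
          { (yes h) → proj₁ (proj₂ (p 0 (x ▹ ρ))) h λ { (y , c) → k (y , proj₂ (i-rule y x) λ { (u , v) → u c }) }
          ; (no ¬h) → proj₁ (proj₂ (q 0 (x ▹ ρ))) (¬h ∘ proj₂ (e x)) λ { (y , c) →
              k (y , proj₂ (i-rule y x) λ { (u , v) → v c }) } }

        decided : ∀ x y → i ∋⟨ 0 ∣ cons y ⌜ x ▹ ρ ⌝ ⟩ → a ∋⟨ 0 ∣ cons y ⌜ x ▹ ρ ⌝ ⟩ ↔ ⟦ φ ⟧ (x ▹ ρ) η
        decided x y h =
          (λ c → proj₂ (proj₂ (p 0 (x ▹ ρ))) λ l → l (y , c)) ,
          λ f → ∋-stable λ c → proj₁ (i-rule y x) h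
            (c , λ d → proj₂ (proj₂ (q 0 (x ▹ ρ))) (λ l → l (y , d)) (proj₁ (e x) f))

        mu≡φ : ∀ x → op mu i a ∋⟨ 0 ∣ ⌜ x ▹ ρ ⌝ ⟩ ↔ ⟦ φ ⟧ (x ▹ ρ) η
        mu≡φ x =
          (λ h → ⟦⟧-stable φ λ k → φ∨¬ψ x λ { (y , c) → mu-rule i a 0 _ y c λ { (z , d , m) →
            k (proj₁ (decided x z d) (proj₁ m h)) } }) ,
          λ f → ∋-stable λ k → φ∨¬ψ x λ { (y , c) → mu-rule i a 0 _ y c λ { (z , d , m) →
            k (proj₂ m (proj₂ (decided x z d) f)) } }
    in k (op bind (op mu i a) ⌜ ρ ⌝ , λ x → ↔-trans (bind-rule (op mu i a) ⌜ ρ ⌝ 0 x 0)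
           (↔-trans (mu≡φ x) (↔-sym (⟦wk²⟧ φ))))

  -- Weak König's lemma in the model

  ⟦Length⟧ : ∀ {n m} (s t : Term n) ρ (η : Vector ℕ m) →
             ⟦ Length s t ⟧ ρ η ↔ 2 ** val s ρ ≤ val t ρ × val t ρ < 2 ** suc (val s ρ)
  ⟦Length⟧ s t ρ η = ×-cong (⟦≼⟧ (exp s) t ρ η)
    (↔-trans (⟦≺⟧ t (exp (s ⊕ 𝟏)) ρ η) (≡⇒↔ (cong (λ z → val t ρ < 2 ** z) (+-comm (val s ρ) 1))))

  -- The lowest digit comes first, so an initial segment of length ℓ is the remainder modulo 2^ℓ
  -- with a new leading 1. This links `_⊑_` to the form in which the conditions treat prefixes.
  ⟦⊑⟧ : ∀ {n m} {ρ : Vector ℕ n} (η : Vector ℕ m) {c λᶜ} ℓ a q → q < 2 ** ℓ → c ≡ suc a * 2 ** ℓ + q →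
        2 ** λᶜ ≤ c → c < 2 ** suc λᶜ → ⟦ v₀ ⊑ v₁ ⟧ ((2 ** ℓ + q) ▹ (c ▹ ρ)) η
  ⟦⊑⟧ {ρ = ρ} η {c} {λᶜ} ℓ a q q< e c≥ c< k = k (ℓ , λ k → k (λᶜ ,
    proj₂ (⟦Length⟧ v₁ (var (# 2)) ρ₂ η) (m≤m+n (2 ** ℓ) q , d<) ,
    proj₂ (⟦Length⟧ v₀ (var (# 3)) ρ₂ η) (c≥ , c<) ,
    proj₂ (⟦≼⟧ v₁ v₀ ρ₂ η) (m<1+n⇒m≤n (≰⇒> λ h → <⇒≱ (≤-<-trans ℓ≤ c<) (^-monoʳ-≤ 2 h))) ,
    λ b b< → ↔-trans (⟦Bit⟧ v₀ (var (# 3)) (b ▹ ρ₂) η) (↔-trans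
      (same b (proj₁ (⟦≺⟧ v₀ (var (# 2)) (b ▹ ρ₂) η) b<))
      (↔-sym (⟦Bit⟧ v₀ (var (# 4)) (b ▹ ρ₂) η)))))
    where
    ρ₂ = λᶜ ▹ (ℓ ▹ ((2 ** ℓ + q) ▹ (c ▹ ρ)))

    d< : 2 ** ℓ + q < 2 ** suc ℓ
    d< = subst (2 ** ℓ + q <_) (cong (2 ** ℓ +_) (sym (+-identityʳ (2 ** ℓ)))) (+-monoʳ-< (2 ** ℓ) q<)

    ℓ≤ : 2 ** ℓ ≤ c
    ℓ≤ = subst (2 ** ℓ ≤_) (sym e) (≤-trans (m≤m+n (2 ** ℓ) (a * 2 ** ℓ)) (m≤m+n _ q))

    same : ∀ b → b < ℓ → bit b (2 ** ℓ + q) ↔ bit b c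
    same b b< = ↔-trans (subst (λ z → bit b (z + q) ↔ bit b q) (*-identityˡ (2 ** ℓ)) (bit-mod b< 1 q))
      (subst (λ z → bit b q ↔ bit b z) (sym e) (↔-sym (bit-mod b< (suc a) q)))

  weak-könig : ⊨ WKL
  -- An element of T above 2^ℓ codes a sequence of length at least ℓ, which is what the condition on
  -- `path` asks for at length ℓ.
  weak-könig T (tree , infinite) k = k (P , λ ℓ k → infinite (2 ** ℓ) λ { (c , ℓ< , c∈T) →
    ¬¬-prefix (λ b → op path T 0 ∋⟨ 0 ∣ cons b 0 ⟩) ℓ λ { (r , r< , bits-r) →
    k (2 ** ℓ + r , on-path ℓ c (<⇒≤ (proj₁ (⟦≺⟧ v₁ v₀ (c ▹ (2 ** ℓ ▹ ρ₀)) ηT) ℓ<)) c∈T r r< bits-r ,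
      proj₂ (⟦Length⟧ v₁ v₀ ((2 ** ℓ + r) ▹ (ℓ ▹ ρ₀)) ηP)
        (m≤m+n (2 ** ℓ) r ,
         subst (2 ** ℓ + r <_) (cong (2 ** ℓ +_) (sym (+-identityʳ (2 ** ℓ)))) (+-monoʳ-< (2 ** ℓ) r<)) ,
      λ b b< → ↔-trans (⟦Bit⟧ v₀ v₁ (b ▹ ((2 ** ℓ + r) ▹ (ℓ ▹ ρ₀))) ηP)
        (low ℓ r bits-r b (proj₁ (⟦≺⟧ v₀ (var (# 2)) (b ▹ ((2 ** ℓ + r) ▹ (ℓ ▹ ρ₀))) ηP) b<))) } })
    where
    P : ℕ
    P = op path T 0

    ρ₀ : Vector ℕ 0
    ρ₀ ()

    ηT : Vector ℕ 1
    ηT _ = T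

    ηP : Vector ℕ 2
    ηP = P ▹ ηT

    low : ∀ ℓ r → (∀ b → b < ℓ → bit b r ↔ P ∋⟨ 0 ∣ cons b 0 ⟩) →
          ∀ b → b < ℓ → bit b (2 ** ℓ + r) ↔ P ∋⟨ 0 ∣ cons b 0 ⟩
    low ℓ r h b b< = ↔-trans
      (subst (λ z → bit b (z + r) ↔ bit b r) (*-identityˡ (2 ** ℓ)) (bit-mod b< 1 r)) (h b b<)

    on-path : ∀ ℓ c → 2 ** ℓ ≤ c → T ∋⟨ 0 ∣ cons c 0 ⟩ → ∀ r → r < 2 ** ℓ →
              (∀ b → b < ℓ → bit b r ↔ P ∋⟨ 0 ∣ cons b 0 ⟩) → T ∋⟨ 0 ∣ cons (2 ** ℓ + r) 0 ⟩
    on-path ℓ c ℓ≤ c∈T r r< h = path-rule T ℓ r (c ∸ 2 ** ℓ) r< (λ ℓ′ a q q< e →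
      ∋-stable λ k → proj₁ (tree c c∈T) λ { (λᶜ , len) →
        let c≥ , c< = proj₁ (⟦Length⟧ v₀ v₁ (λᶜ ▹ (c ▹ ρ₀)) ηT) len
        in k (proj₂ (tree c c∈T) (2 ** ℓ′ + q)
             (⟦⊑⟧ {ρ = ρ₀} ηT {λᶜ = λᶜ} ℓ′ a q q< (trans (sym (m+[n∸m]≡n ℓ≤)) e) c≥ c<)) }) h

  ⊨RCA₀* : ∀ {σ} → RCA₀* σ → ⊨ σ
  ⊨RCA₀* suc≢0  x e = contradiction (trans (+-comm 1 x) e) λ ()
  ⊨RCA₀* sucInj x y e = +-cancelʳ-≡ 1 x y e
  ⊨RCA₀* pred zero    h = contradiction refl h
  ⊨RCA₀* pred (suc x) h k = k (x , +-comm 1 x)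
  ⊨RCA₀* +0     x = +-identityʳ x
  ⊨RCA₀* +suc   x y = sym (+-assoc x y 1)
  ⊨RCA₀* ·0     x = *-zeroʳ x
  ⊨RCA₀* ·suc   x y = trans (*-distribˡ-+ x y 1) (cong (x * y +_) (*-identityʳ x))
  ⊨RCA₀* exp0   = refl
  ⊨RCA₀* expSuc x = cong (2 **_) (+-comm x 1)
  ⊨RCA₀* (Δ⁰₀-IND {φ = φ} _) = ⊨Induction φ
  ⊨RCA₀* (Δ⁰₁-CA σ π) = comprehension σ π

  ⊨RCA₀ : ∀ {σ} → RCA₀ σ → ⊨ σ
  ⊨RCA₀ (base a) = ⊨RCA₀* a
  ⊨RCA₀ (Σ⁰₁-IND {φ = φ} _) = ⊨Induction φ

  ⊨WKL₀ : ∀ {σ} → WKL₀ σ → ⊨ σ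
  ⊨WKL₀ (base a) = ⊨RCA₀ a
  ⊨WKL₀ wkl      = weak-könig

-- Derivation from reflection

subT-fusion : ∀ {n n′ n″} {σ : Vector (Term n″) n′} {τ : Vector (Term n′) n} {υ} →
              (∀ i → subT σ (τ i) ≡ υ i) → ∀ t → subT σ (subT τ t) ≡ subT υ t
subT-fusion h (var i) = h i
subT-fusion h 𝟎       = refl
subT-fusion h 𝟏       = refl
subT-fusion h (s ⊕ t) = cong₂ _⊕_ (subT-fusion h s) (subT-fusion h t)
subT-fusion h (s ⊗ t) = cong₂ _⊗_ (subT-fusion h s) (subT-fusion h t)
subT-fusion h (exp t) = cong exp (subT-fusion h t)

subT-wkT : ∀ {n n′} (σ : Vector (Term n′) n) t → subT (v₀ ▹ (wkT ∘ σ)) (wkT t) ≡ wkT (subT σ t)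
subT-wkT σ t = trans (subT-fusion (λ _ → refl) t) (sym (subT-fusion (λ _ → refl) t))

sub-fusion : ∀ {n n′ n″ m m′ m″} (φ : Formula n m) {σ : Vector (Term n″) n′} {τ : Vector (Term n′) n} {υ}
             {ρ : Fin m′ → Fin m″} {π : Fin m → Fin m′} {κ} →
             (∀ i → subT σ (τ i) ≡ υ i) → (∀ X → ρ (π X) ≡ κ X) → sub σ ρ (sub τ π φ) ≡ sub υ κ φ
sub-fusion (s ≐ t) h g = cong₂ _≐_ (subT-fusion h s) (subT-fusion h t)
sub-fusion (t ∈ X) h g = cong₂ _∈_ (subT-fusion h t) (g X)
sub-fusion ⊥       h g = refl
sub-fusion (φ ∧ ψ) h g = cong₂ _∧_ (sub-fusion φ h g) (sub-fusion ψ h g)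
sub-fusion (φ ∨ ψ) h g = cong₂ _∨_ (sub-fusion φ h g) (sub-fusion ψ h g)
sub-fusion (φ ⇒ ψ) h g = cong₂ _⇒_ (sub-fusion φ h g) (sub-fusion ψ h g)
sub-fusion (∀¹ φ) {σ} {τ} h g = cong ∀¹ (sub-fusion φ
  (λ { zero → refl ; (suc i) → trans (subT-wkT σ (τ i)) (cong wkT (h i)) }) g)
sub-fusion (∃¹ φ) {σ} {τ} h g = cong ∃¹ (sub-fusion φ
  (λ { zero → refl ; (suc i) → trans (subT-wkT σ (τ i)) (cong wkT (h i)) }) g)
sub-fusion (∀² φ) h g = cong ∀² (sub-fusion φ h λ { zero → refl ; (suc X) → cong suc (g X) })
sub-fusion (∃² φ) h g = cong ∃² (sub-fusion φ h λ { zero → refl ; (suc X) → cong suc (g X) })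

sub-arithmetical : ∀ {n n′ m m′} {σ : Vector (Term n′) n} {ρ : Fin m → Fin m′} {φ} →
                   Arithmetical φ → Arithmetical (sub σ ρ φ)
sub-arithmetical (s ≐ t) = _ ≐ _
sub-arithmetical (t ∈ X) = _ ∈ _
sub-arithmetical ⊥       = ⊥
sub-arithmetical (φ ∧ ψ) = sub-arithmetical φ ∧ sub-arithmetical ψ
sub-arithmetical (φ ∨ ψ) = sub-arithmetical φ ∨ sub-arithmetical ψ
sub-arithmetical (φ ⇒ ψ) = sub-arithmetical φ ⇒ sub-arithmetical ψ
sub-arithmetical (∀¹ φ)  = ∀¹ (sub-arithmetical φ)
sub-arithmetical (∃¹ φ)  = ∃¹ (sub-arithmetical φ)

^-arithmetical : ∀ {n m} {φ : Formula n m} → Arithmetical φ → ∀ Y → φ ^ Y ≡ φ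
^-arithmetical (s ≐ t) Y = refl
^-arithmetical (t ∈ X) Y = refl
^-arithmetical ⊥       Y = refl
^-arithmetical (φ ∧ ψ) Y = cong₂ _∧_ (^-arithmetical φ Y) (^-arithmetical ψ Y)
^-arithmetical (φ ∨ ψ) Y = cong₂ _∨_ (^-arithmetical φ Y) (^-arithmetical ψ Y)
^-arithmetical (φ ⇒ ψ) Y = cong₂ _⇒_ (^-arithmetical φ Y) (^-arithmetical ψ Y)
^-arithmetical (∀¹ φ)  Y = cong ∀¹ (^-arithmetical φ Y)
^-arithmetical (∃¹ φ)  Y = cong ∃¹ (^-arithmetical φ Y)

module Reflection (θ : Formula 2 0) (θ-arithmetical : Arithmetical θ) where

  Θ : ∀ {n m} → Term n → Term n → Formula n m
  Θ x e = sub (x ▹ (e ▹ λ ())) (λ ()) θ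

  sub-Θ : ∀ {n n′ m m′} (τ : Vector (Term n′) n) (ρ : Fin m → Fin m′) x e →
          sub τ ρ (Θ x e) ≡ Θ (subT τ x) (subT τ e)
  sub-Θ τ ρ x e = sub-fusion θ (λ { zero → refl ; (suc zero) → refl }) λ ()

  IsSlice : ∀ {n m} → Fin m → Term n → Formula n m
  IsSlice X e = ∀¹ (v₀ ∈ X ⇔ Θ v₀ (wkT e))

  sub-slice : ∀ {n n′ m m′} (τ : Vector (Term n′) n) (ρ : Fin m → Fin m′) X e →
              sub τ ρ (IsSlice X e) ≡ IsSlice (ρ X) (subT τ e)
  sub-slice τ ρ X e = cong (λ φ → ∀¹ (v₀ ∈ ρ X ⇔ φ))
    (trans (sub-Θ (v₀ ▹ (wkT ∘ τ)) ρ v₀ (wkT e)) (cong (Θ v₀) (subT-wkT τ e)))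

  slice-arithmetical : ∀ {n m} (X : Fin m) (e : Term n) → Arithmetical (IsSlice X e)
  slice-arithmetical X e =
    ∀¹ ((_ ∈ _ ⇒ sub-arithmetical θ-arithmetical) ∧ (sub-arithmetical θ-arithmetical ⇒ _ ∈ _))

  nonSlice : ∀ {n m} → Formula n m
  nonSlice = ∃² (∀¹ (∼ IsSlice zero v₀))

  nonSlice-Σ¹₁ : ∀ {n m} → Σ¹₁ (nonSlice {n} {m})
  nonSlice-Σ¹₁ = ∃² (matrix (∀¹ (slice-arithmetical zero v₀ ⇒ ⊥)))

  wk²-nonSlice : ∀ {n m} → wk² (nonSlice {n} {m}) ≡ nonSlice
  wk²-nonSlice = cong (λ φ → ∃² (∀¹ (∼ φ))) (sub-slice (v₀ ▹ (wkT ∘ var)) (lift 1 suc) zero v₀)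

  -- The premise `⊤` is the empty conjunction that `Rfn` produces for k = 0.
  Reflects : ∀ {n m} → Fin m → Term n → Formula n m
  Reflects Y e = ⊤ ⇒ (∃² (IsSlice zero e) ⇔ ∃² (zero ∈̇ suc Y ∧ IsSlice zero e))

  reflects-cong : ∀ {n m Y} {e : Term n} {φ ψ : Formula n (suc m)} → φ ≡ IsSlice zero e → ψ ≡ IsSlice zero e →
                  (⊤ ⇒ (∃² φ ⇔ ∃² (zero ∈̇ suc Y ∧ ψ))) ≡ Reflects Y e
  reflects-cong refl refl = refl

  sub-reflects : ∀ {n n′ m m′} (τ : Vector (Term n′) n) (ρ : Fin m → Fin m′) Y e →
                 sub τ ρ (Reflects Y e) ≡ Reflects (ρ Y) (subT τ e)
  sub-reflects τ ρ Y e =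
    reflects-cong {Y = ρ Y} {subT τ e} (sub-slice τ (lift 1 ρ) zero e) (sub-slice τ (lift 1 ρ) zero e)

  rfn-slice : embed {0} {0} (Rfn {1} 0 0 (∃² (IsSlice zero v₀))) ≡ ∃² (⊤ ∧ ∀¹ (Reflects zero v₀))
  rfn-slice = cong (λ φ → ∃² (⊤ ∧ ∀¹ φ)) (reflects-cong
    (trans (cong (sub τ ρ) slice) (sub-slice τ ρ zero v₀))
    (trans (cong (sub τ ρ) (trans (cong (_^ suc zero) slice)
        (^-arithmetical (slice-arithmetical zero v₀) (suc zero))))
      (sub-slice τ ρ zero v₀)))
    where
    τ : Vector (Term 1) 1
    τ = var zero ▹ (wkT ∘ λ ())

    ρ : Fin 2 → Fin 2
    ρ = lift 1 (lift 1 λ ())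

    slice : sub {1} {1} {1} {2} var (lift 1 (lift 0 suc)) (IsSlice zero v₀) ≡ IsSlice zero v₀
    slice = sub-slice var (lift 1 (lift 0 suc)) zero v₀

  module Derivation {T : Theory} (rca : ∀ {σ} → RCA₀* σ → T σ) (reflection : ∀ {σ} → Σ¹₁-Rfn σ → T σ) where

    conv : ∀ {n m} {Γ : List (Formula n m)} {φ ψ} → φ ≡ ψ → T ▸ Γ ⊢ φ → T ▸ Γ ⊢ ψ
    conv refl d = d

    nth : ∀ {n m} {Γ : List (Formula n m)} i → T ▸ Γ ⊢ lookup Γ i
    nth i = hyp (∈-lookup i)

    hyp₀ : ∀ {n m} {Γ : List (Formula n m)} {φ} → T ▸ φ ∷ Γ ⊢ φ
    hyp₀ = nth zero

    -- x ∈ (Y)ₓ by a pair p < B + 1, where 2p = B.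
    OnDiagonal : ∀ {n m} → Term n → Fin m → Formula n m
    OnDiagonal x Y = ∃¹ (v₀ ≺ wkT ((x ⊕ x) ⊗ (x ⊕ x ⊕ 𝟏) ⊕ (x ⊕ x) ⊕ 𝟏) ∧ (Pair (wkT x) (wkT x) v₀ ∧ v₀ ∈ Y))

    -- With 2p = B, the bound p < B + 1 takes no induction: p itself witnesses it, since p + (p + 1)
    -- = (p + p) + 1 is an instance of the recursion axiom for addition.
    onDiagonal-complete : ∀ {n m} {Γ : List (Formula n m)} i Y →
                          T ▸ Γ ⊢ InSection (var i) Y (var i) ⇒ OnDiagonal (var i) Y
    onDiagonal-complete i Y = ⇒I (∃¹E hyp₀ (∃¹I v₀ (∧I (∃¹I v₀
      (≐E (v₁ ⊕ (v₁ ⊕ 𝟏) ≐ v₀ ⊕ 𝟏) (∧E₁ hyp₀) (∀¹E (∀¹E (axiom (rca +suc)) v₀) v₀))) hyp₀)))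

    onDiagonal-sound : ∀ {n m} {Γ : List (Formula n m)} i Y →
                       T ▸ Γ ⊢ OnDiagonal (var i) Y ⇒ InSection (var i) Y (var i)
    onDiagonal-sound i Y = ⇒I (∃¹E hyp₀ (∃¹I v₀ (∧E₂ hyp₀)))

    diagonal : ∀ {n} {Γ : List (Formula n 1)} → T ▸ Γ ⊢ ∃² (∀¹ (v₀ ∈ zero ⇔ ∼ OnDiagonal v₀ (suc zero)))
    diagonal = ⇒E (∀²E (axiom (rca (Δ⁰₁-CA {φ = ∼ OnDiagonal v₀ zero} (matrix δ) (matrix δ)))) zero)
                  (∀¹I (∧I (⇒I hyp₀) (⇒I hyp₀)))
      where
      δ : Δ⁰₀ {1} {1} (∼ OnDiagonal v₀ zero)
      δ = ∃≺ ((v₀ ⊕ v₀) ⊗ (v₀ ⊕ v₀ ⊕ 𝟏) ⊕ (v₀ ⊕ v₀) ⊕ 𝟏) (_ ≐ _ ∧ _ ∈ _) ⇒ ⊥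

    -- The propositional core of Cantor's argument at an index i of a section Z: s is i ∈ (Y)ᵢ, o
    -- its bounded form, z is i ∈ Z, t is θ(i, e), and d is membership of i in the diagonal set.
    diagonal-argument : ∀ {n m} {Γ : List (Formula n m)} {s z t d o} →
      T ▸ Γ ⊢ (s ⇔ z) ⇒ (z ⇔ t) ⇒ (d ⇔ t) ⇒ (d ⇔ ∼ o) ⇒ (s ⇒ o) ⇒ (o ⇒ s) ⇒ ⊥
    diagonal-argument {Γ = Γ} {s} {z} {t} {d} {o} = ⇒I (⇒I (⇒I (⇒I (⇒I (⇒I (⇒E ∼o (⇒E (nth (# 1))
      (⇒E (∧E₂ (nth (# 5))) (⇒E (∧E₂ (nth (# 4))) (⇒E (∧E₁ (nth (# 3))) (⇒E (∧E₂ (nth (# 2))) ∼o)))))))))))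
      where
      ∼o : T ▸ (o ⇒ s) ∷ (s ⇒ o) ∷ (d ⇔ ∼ o) ∷ (d ⇔ t) ∷ (z ⇔ t) ∷ (s ⇔ z) ∷ Γ ⊢ ∼ o
      ∼o = ⇒I (⇒E (⇒E (∧E₁ (nth (# 3))) (⇒E (∧E₂ (nth (# 4))) (⇒E (∧E₁ (nth (# 5)))
             (⇒E (∧E₁ (nth (# 6))) (⇒E (nth (# 1)) hyp₀))))) hyp₀)

    Y₃ : Fin 3
    Y₃ = suc (suc zero)

    notSlice : T ▸ IsSlice {1} {2} zero v₀ ∷ (∀¹ (v₀ ∈ zero ⇔ ∼ OnDiagonal v₀ (suc zero))) ∷
               wk¹ (wk² (⊤ ∧ ∀¹ (Reflects zero v₀))) ∷ [] ⊢ ⊥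
    notSlice = ∃²E (⇒E (∧E₁ (⇒E reflects (⇒I hyp₀)))
        (∃²I zero (conv (sym (sub-slice var (zero ▹ id) zero v₀)) hyp₀)))
      -- The diagonal is taken at the index of Z in Y that reflection supplies, which is unrelated
      -- to the number e.
      (∃¹E (∧E₁ hyp₀) (⇒E (⇒E (⇒E (⇒E (⇒E (⇒E diagonal-argument
        (∀¹E hyp₀ v₀))
        (∀¹E (conv (sub-slice (var ∘ suc) id zero v₀) (∧E₂ (nth (# 1)))) v₀))
        (∀¹E (conv (trans (cong wk¹ (sub-slice var suc zero v₀))
                          (sub-slice (var ∘ suc) id (suc zero) v₀)) (nth (# 2))) v₀))
        (∀¹E (nth (# 3)) v₀))
        (onDiagonal-complete zero Y₃))
        (onDiagonal-sound zero Y₃)))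
      where
      reflects : T ▸ _ ⊢ Reflects (suc zero) v₀
      reflects = conv (trans
          (cong (λ φ → φ [ v₀ ]¹) (trans
            (cong (sub (v₀ ▹ (wkT ∘ var ∘ suc)) id) (sub-reflects (v₀ ▹ (wkT ∘ var)) suc zero v₀))
            (sub-reflects (v₀ ▹ (wkT ∘ var ∘ suc)) id (suc zero) v₀)))
          (sub-reflects (v₀ ▹ var) id (suc zero) v₀))
        (∀¹E (∧E₂ (nth (# 2))) v₀)

    derivation : T ⊢ nonSlice
    derivation = ∃²E (conv rfn-slice (axiom (reflection (rfn {1} 0 0 {∃² (IsSlice zero v₀)}
        (inj₁ (∃² (matrix (slice-arithmetical zero v₀))))))))
      (conv (sym wk²-nonSlice) (∃²E diagonal (conv (sym wk²-nonSlice)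
        (∃²I zero (conv (sym instance₀) (∀¹I (⇒I notSlice)))))))
      where
      instance₀ : (∀¹ (∼ IsSlice {1} {3} zero v₀)) [ zero ]² ≡ ∀¹ (∼ IsSlice {1} {2} zero v₀)
      instance₀ = cong (λ φ → ∀¹ (∼ φ)) (sub-slice (v₀ ▹ (wkT ∘ var)) (zero ▹ id) zero v₀)

-- The arithmetically coded model and the conclusion

module Basis = ArithmeticalBasis clauses-Δ⁰₀ solution solution-solves

abstract
  W : Real
  W = Basis.W

  W-closed : ∀ n → sat clauses (λ _ → n) W
  W-closed = Basis.W-solves

  defining : Formula 1 0
  defining = Basis.defining

  defining-arithmetical : Arithmetical defining
  defining-arithmetical = Basis.defining-arithmetical

  ⟦defining⟧ : ∀ 𝔐 ρ η → Satisfaction.⟦_⟧ 𝔐 defining ρ η ↔ Real.at W (ρ zero)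
  ⟦defining⟧ = Basis.⟦defining⟧

open Model W W-closed using (𝔐; ∋⇔W; ⊨RCA₀; ⊨WKL₀)
open Satisfaction 𝔐

member : Vector (Term 2) 1
member _ = v₁ ∷ᵗ (𝟎 ∷ᵗ (v₀ ∷ᵗ 𝟎))

-- The θ of the overview, x being variable 0 and e variable 1: the code of the configuration with
-- program e, empty store and x alone on the stack lies in `W`.
membership : Formula 2 0
membership = sub member id defining

open Reflection membership (sub-arithmetical {σ = member} {ρ = id} defining-arithmetical)

every-set-is-slice : ∀ {n} X x (ρ : Vector ℕ n) {η : Vector ℕ 1} →
                     ωStructure._∋_ 𝔐 X x ↔ ⟦ Θ v₀ v₁ ⟧ (x ▹ (X ▹ ρ)) η
every-set-is-slice X x ρ {η} = ↔-trans (∋⇔W X x) (↔-sym (↔-trans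
  (⟦sub⟧ membership {σ = v₀ ▹ (v₁ ▹ λ ())} {ρ′ = ρ₂} {η′ = λ ()} (λ { zero → refl ; (suc zero) → refl }) λ ())
  (↔-trans (⟦sub⟧ defining {σ = member} {ρ = ρ₂} {ρ′ = λ i → val (member i) ρ₂} {η′ = λ ()} (λ _ → refl) (λ ()))
    (⟦defining⟧ 𝔐 (λ i → val (member i) ρ₂) λ ()))))
  where
  ρ₂ : Vector ℕ 2
  ρ₂ = x ▹ (X ▹ λ ())

⊭nonSlice : ¬ ⊨ nonSlice
-- The number e at which X is a slice is the index X itself.
⊭nonSlice h = h λ (X , k) → k X λ x → every-set-is-slice X x _

corollary6p2 : (∃[ σ ] (Σ¹₁ σ × ((RCA₀ ∪ Σ¹₁-Rfn) ⊢ σ) × ¬ (RCA₀ ⊢ σ))) ×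
    (∃[ σ ] (Σ¹₁ σ × ((WKL₀ ∪ Σ¹₁-Rfn) ⊢ σ) × ¬ (WKL₀ ⊢ σ)))
corollary6p2 =
  (nonSlice , nonSlice-Σ¹₁ , Derivation.derivation (λ a → inj₁ (base a)) inj₂ ,
   λ d → ⊭nonSlice (sound ⊨RCA₀ d λ ())) ,
  (nonSlice , nonSlice-Σ¹₁ , Derivation.derivation (λ a → inj₁ (base (base a))) inj₂ ,
   λ d → ⊭nonSlice (sound ⊨WKL₀ d λ ()))
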